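{- Average-energy games are determined and both players have memoryless optimal strategies: for every game $G=(S_1,S_2,E,w)$ and initial state $s_{init}$ there exist a value $v\in\mathbb{R}\cup\{ -\infty,+\infty\}$, a memoryless strategy $\sigma_1$ of player 1 and a memoryless strategy $\sigma_2$ of player 2 such that every play from $s_{init}$ consistent with $\sigma_1$ has $\overline{\mathrm{AE}}(\pi)\le v$ and every play from $s_{init}$ consistent with $\sigma_2$ has $\overline{\mathrm{AE}}(\pi)\ge v$. In particular, for every $t\in\mathbb{Q}$, either player 1 has a memoryless winning strategy for $\mathrm{AvgEnergy}(t)$ from $s_{init}$ or player 2 has a memoryless winning strategy (against $\mathrm{AvgEnergy}(t)$) from $s_{init}$. The same holds with $\underline{\mathrm{AE}}$ in place of $\overline{\mathrm{AE}}$.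
   Context: A game is a tuple $G=(S_1,S_2,E,w)$ where $S_1,S_2$ are disjoint finite sets of states (belonging to player 1 and player 2 respectively), $S=S_1\uplus S_2$, $E\subseteq S\times S$ is a set of edges such that every $s\in S$ has at least one $s'$ with $(s,s')\in E$, and $w\colon E\to\mathbb{Z}$ is a weight function. A play from $s_{init}$ is an infinite sequence $\pi=s_0s_1\dots$ with $s_0=s_{init}$ and $(s_i,s_{i+1})\in E$; $\pi(n)=s_0\dots s_n$. Energy level $\mathrm{EL}(\pi(n))=\sum_{i=0}^{n-1}w(s_i,s_{i+1})$; average-energy $\overline{\mathrm{AE}}(\pi)=\limsup_{n\to\infty}\frac1n\sum_{i=1}^{n}\mathrm{EL}(\pi(i))$, and $\underline{\mathrm{AE}}$ is defined with $\liminf$. A strategy of player $i$ maps each finite prefix whose last state is in $S_i$ to a successor of that state; it is memoryless if its choice depends only on the last state. A play is consistent with a strategy if the strategy's owner always moves as prescribed. Player 1 (the minimizer) wins from $s_{init}$ for an objective $\mathcal{W}$ with a strategy if all consistent plays from $s_{init}$ lie in $\mathcal{W}$; player 2 wins with a strategy if no consistent play from $s_{init}$ lies in $\mathcal{W}$. $\mathrm{AvgEnergy}(t)=\{\pi\mid\overline{\mathrm{AE}}(\pi)\le t\}$. -}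

module Defs where

open import Data.Nat using (ℕ; zero; suc; _≥_)
open import Data.Fin using (Fin)
open import Data.Bool using (Bool; true)
open import Data.Integer as ℤ using (ℤ; +_)
open import Data.Rational using (ℚ; _/_; _<_; _>_)
open import Data.Product using (Σ; ∃; _×_)
open import Data.Sum using (_⊎_)
open import Relation.Nullary using (¬_)
open import Relation.Binary.PropositionalEquality using (_≡_)

data Player : Set where
  P1 P2 : Player

-- A game G = (S₁, S₂, E, w) with finite state set S = Fin n;
-- S₁ = owner⁻¹(P1), S₂ = owner⁻¹(P2); E given by 'edge'; w only matters on edges.
record Game : Set where
  field
    n      : ℕ
    owner  : Fin n → Player
    edge   : Fin n → Fin n → Bool
    w      : Fin n → Fin n → ℤ
    total  : ∀ s → ∃ λ s' → edge s s' ≡ true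

module _ (G : Game) where
  open Game G

  State : Set
  State = Fin n

  record Play (s₀ : State) : Set where
    field
      π     : ℕ → State
      start : π 0 ≡ s₀
      step  : ∀ i → edge (π i) (π (suc i)) ≡ true

  -- A memoryless strategy (for either player): a choice of successor per state
  -- (only its values on the owner's states matter).
  record Memoryless : Set where
    field
      choose : State → State
      legal  : ∀ s → edge s (choose s) ≡ true

  Consistent : ∀ {s₀} → Player → Memoryless → Play s₀ → Set
  Consistent p σ ρ = ∀ i → owner (π i) ≡ p → π (suc i) ≡ Memoryless.choose σ (π i)
    where open Play ρ

  EL : (ℕ → State) → ℕ → ℤ
  EL π zero    = + 0
  EL π (suc k) = EL π k ℤ.+ w (π k) (π (suc k))

  SumEL : (ℕ → State) → ℕ → ℤ
  SumEL π zero    = + 0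
  SumEL π (suc m) = SumEL π m ℤ.+ EL π (suc m)

  -- avg π m = (1/(m+1)) Σ_{i=1}^{m+1} EL(π(i))   (the (m+1)-th term of the sequence)
  avg : (ℕ → State) → ℕ → ℚ
  avg π m = SumEL π (suc m) / suc m

-- Extended reals ℝ ∪ {-∞,+∞} as (constructive) Dedekind cuts on ℚ, with the
-- boundedness conditions dropped: L = {q | q < v}, U = {q | v < q}.
-- L empty / U = ℚ encodes -∞; L = ℚ / U empty encodes +∞.
record ExtReal : Set₁ where
  field
    L U      : ℚ → Set
    L-lower  : ∀ {q r} → r < q → L q → L r
    L-round  : ∀ {q} → L q → ∃ λ r → q < r × L r
    U-upper  : ∀ {q r} → q < r → U q → U r
    U-round  : ∀ {q} → U q → ∃ λ r → r < q × U r
    disjoint : ∀ {q} → ¬ (L q × U q)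
    located  : ∀ {q r} → q < r → L q ⊎ U r

-- limsup / liminf of a rational sequence compared with an extended real v
-- (classical meaning: limsup a ≤ v ⇔ ∀ q > v, eventually a_m < q, etc.)
LimsupLe : (ℕ → ℚ) → ExtReal → Set
LimsupLe a v = ∀ q → ExtReal.U v q → Σ ℕ λ N → ∀ m → m ≥ N → a m < q

LimsupGe : (ℕ → ℚ) → ExtReal → Set
LimsupGe a v = ∀ q → ExtReal.L v q → ∀ N → Σ ℕ λ m → m ≥ N × a m > q

LiminfLe : (ℕ → ℚ) → ExtReal → Set
LiminfLe a v = ∀ q → ExtReal.U v q → ∀ N → Σ ℕ λ m → m ≥ N × a m < q

LiminfGe : (ℕ → ℚ) → ExtReal → Set
LiminfGe a v = ∀ q → ExtReal.L v q → Σ ℕ λ N → ∀ m → m ≥ N → a m > q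

LimsupLeℚ : (ℕ → ℚ) → ℚ → Set
LimsupLeℚ a t = ∀ q → t < q → Σ ℕ λ N → ∀ m → m ≥ N → a m < q

LiminfLeℚ : (ℕ → ℚ) → ℚ → Set
LiminfLeℚ a t = ∀ q → t < q → ∀ N → Σ ℕ λ m → m ≥ N × a m < q

module _ (G : Game) where
  AEsup≤ AEsup≥ AEinf≤ AEinf≥ : ∀ {s₀} → Play G s₀ → ExtReal → Set
  AEsup≤ ρ v = LimsupLe (avg G (Play.π ρ)) v
  AEsup≥ ρ v = LimsupGe (avg G (Play.π ρ)) v
  AEinf≤ ρ v = LiminfLe (avg G (Play.π ρ)) v
  AEinf≥ ρ v = LiminfGe (avg G (Play.π ρ)) v

  InAvgEnergy InAvgEnergyInf : ∀ {s₀} → ℚ → Play G s₀ → Set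
  InAvgEnergy    t ρ = LimsupLeℚ (avg G (Play.π ρ)) t
  InAvgEnergyInf t ρ = LiminfLeℚ (avg G (Play.π ρ)) t

  Determined : State G → (∀ {s₀} → Play G s₀ → ExtReal → Set)
                        → (∀ {s₀} → Play G s₀ → ExtReal → Set) → Set₁
  Determined s₀ Le Ge =
    Σ ExtReal λ v → Σ (Memoryless G) λ σ₁ → Σ (Memoryless G) λ σ₂ →
      (∀ (ρ : Play G s₀) → Consistent G P1 σ₁ ρ → Le ρ v) ×
      (∀ (ρ : Play G s₀) → Consistent G P2 σ₂ ρ → Ge ρ v)

  ThresholdDetermined : State G → (∀ {s₀} → Play G s₀ → Set) → Set
  ThresholdDetermined s₀ W =
    (Σ (Memoryless G) λ σ₁ → ∀ (ρ : Play G s₀) → Consistent G P1 σ₁ ρ → W ρ)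
    ⊎ (Σ (Memoryless G) λ σ₂ → ∀ (ρ : Play G s₀) → Consistent G P2 σ₂ ρ → ¬ W ρ)

{-# OPTIONS --safe #-}
module Submission where

-- The value is found by passing to discounted games with discount factor 1 − ε for an
-- infinitesimal ε: along a play of mean-payoff 0 the average energy is the Abel limit of
-- the discounted sums, so a strategy that is optimal for all small ε > 0 (Blackwell
-- optimal) is optimal for the average energy.  Discounted values are represented as
-- polynomials in ε, ordered by the sign of the lowest nonzero coefficient.
-- Memoryless optimal strategies in the discounted game are obtained by splitting the
-- choices at one state between two subgames: the subgame whose value at that state is
-- better for its owner solves the whole game, since the two values differ nowhere more
-- than there and discounting contracts the difference.  The coefficients of orders 0, 1, 2
-- of the optimality equations form a lexicographic potential which bounds Σ EL(π(i)) for
-- every consistent play: order 0 gives the mean-payoff, order 1 the average energy, and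
-- order 2 keeps the error bounded.

open import Defs
open import Data.Bool using (true)
import Data.Bool.Properties as Bool
open import Data.Empty using (⊥; ⊥-elim)
open import Data.Fin using (Fin; zero; suc; toℕ)
import Data.Fin.Properties as Fin
open import Data.Integer hiding (suc; pred; _≟_)
open import Data.Integer.Properties hiding (_≟_)
open import Data.Integer.Tactic.RingSolver using (solve-∀)
open import Data.List using (List; []; _∷_; allFin; filter)
open import Data.List.Membership.Propositional using (_∈_)
open import Data.List.Membership.Propositional.Properties using (∈-filter⁺; ∈-filter⁻; ∈-allFin)
open import Data.List.Relation.Unary.Any using (here; there)
open import Data.Nat as ℕ using (ℕ; zero; suc; _!)
open import Data.Nat.Divisibility using (_∣_; divides; ∣-trans; m∣m*n; m≤n⇒m!∣n!)
import Data.Nat.Properties as ℕ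
open import Data.Product using (∃; _×_; _,_; proj₁; proj₂)
open import Data.Rational as ℚ using (ℚ; ↥_; ↧_; toℚᵘ)
import Data.Rational.Properties as ℚ
open import Data.Rational.Unnormalised as ℚᵘ using (mkℚᵘ)
import Data.Rational.Unnormalised.Properties as ℚᵘ
open import Data.Sum as Sum using (_⊎_; inj₁; inj₂; [_,_]′)
open import Data.Unit using (⊤; tt)
open import Data.Vec.Functional using (updateAt)
open import Data.Vec.Functional.Properties using (updateAt-updates; updateAt-minimal; updateAt-id-local)
open import Function using (_∘_; id)
open import Relation.Binary using (tri<; tri≈; tri>)
open import Relation.Binary.PropositionalEquality
open import Relation.Nullary using (¬_; yes; no)

-- Power series in ε: lexicographic order and discounting.

Series : Set
Series = ℕ → ℤ

infixl 6 _⊞_ _⊟_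
infix 4 _⪯_

_⊞_ _⊟_ : Series → Series → Series
(f ⊞ g) k = f k + g k
(f ⊟ g) k = f k - g k

constant : ℤ → Series
constant c zero    = c
constant c (suc _) = 0ℤ

Vanishing Pos NonNeg FinDeg : Series → Set
Vanishing f = ∀ k → f k ≡ 0ℤ
Pos f       = ∃ λ k → (∀ j → j ℕ.< k → f j ≡ 0ℤ) × 0ℤ < f k
NonNeg f    = Vanishing f ⊎ Pos f
FinDeg f    = ∃ λ d → ∀ k → d ℕ.≤ k → f k ≡ 0ℤ

_⪯_ : Series → Series → Set
f ⪯ g = NonNeg (g ⊟ f)

Pos-cong : ∀ {f g} → f ≗ g → Pos f → Pos g
Pos-cong f≗g (k , below , 0<fk) =
  k , (λ j j<k → trans (sym (f≗g j)) (below j j<k)) , subst (0ℤ <_) (f≗g k) 0<fk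

NonNeg-cong : ∀ {f g} → f ≗ g → NonNeg f → NonNeg g
NonNeg-cong f≗g (inj₁ f≗0) = inj₁ λ k → trans (sym (f≗g k)) (f≗0 k)
NonNeg-cong f≗g (inj₂ 0<f) = inj₂ (Pos-cong f≗g 0<f)

Vanishing⇒¬Pos : ∀ {f} → Vanishing f → ¬ Pos f
Vanishing⇒¬Pos f≗0 (k , _ , 0<fk) = <-irrefl (sym (f≗0 k)) 0<fk

Pos-⊞ : ∀ {f g} → Pos f → NonNeg g → Pos (f ⊞ g)
Pos-⊞ {f} (k , below , 0<fk) (inj₁ g≗0) =
  k , (λ j j<k → cong₂ _+_ (below j j<k) (g≗0 j)) , +-mono-<-≤ 0<fk (≤-reflexive (sym (g≗0 k)))
Pos-⊞ {f} {g} (k , belowF , 0<fk) (inj₂ (l , belowG , 0<gl)) with ℕ.<-cmp k l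
... | tri< k<l _ _ =
  k , (λ j j<k → cong₂ _+_ (belowF j j<k) (belowG j (ℕ.<-trans j<k k<l))) ,
  +-mono-<-≤ 0<fk (≤-reflexive (sym (belowG k k<l)))
... | tri≈ _ refl _ =
  k , (λ j j<k → cong₂ _+_ (belowF j j<k) (belowG j j<k)) , +-mono-< 0<fk 0<gl
... | tri> _ _ l<k =
  l , (λ j j<l → cong₂ _+_ (belowF j (ℕ.<-trans j<l l<k)) (belowG j j<l)) ,
  +-mono-≤-< (≤-reflexive (sym (belowF l l<k))) 0<gl

NonNeg-⊞ : ∀ {f g} → NonNeg f → NonNeg g → NonNeg (f ⊞ g)
NonNeg-⊞ (inj₂ 0<f) 0≤g        = inj₂ (Pos-⊞ 0<f 0≤g)
NonNeg-⊞ {f} {g} (inj₁ f≗0) (inj₂ 0<g) =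
  inj₂ (Pos-cong (λ k → +-comm (g k) (f k)) (Pos-⊞ 0<g (inj₁ f≗0)))
NonNeg-⊞ (inj₁ f≗0) (inj₁ g≗0) = inj₁ λ k → cong₂ _+_ (f≗0 k) (g≗0 k)

-- Finite degree makes the sign decidable: the lowest coefficient is tested, and a zero there passes
-- the question to the shifted series.
NonNeg⊎Pos : ∀ f d → (∀ k → d ℕ.≤ k → f k ≡ 0ℤ) → NonNeg f ⊎ Pos (-_ ∘ f)
NonNeg⊎Pos f zero    above = inj₁ (inj₁ λ k → above k ℕ.z≤n)
NonNeg⊎Pos f (suc d) above with <-cmp 0ℤ (f 0)
... | tri< 0<f₀ _ _ = inj₁ (inj₂ (0 , (λ _ ()) , 0<f₀))
... | tri> _ _ f₀<0 = inj₂ (0 , (λ _ ()) , neg-mono-< f₀<0)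
... | tri≈ _ 0≡f₀ _ with NonNeg⊎Pos (f ∘ suc) d (λ k d≤k → above (suc k) (ℕ.s≤s d≤k))
... | inj₁ (inj₁ tail≗0) = inj₁ (inj₁ λ where
        zero    → sym 0≡f₀
        (suc k) → tail≗0 k)
... | inj₁ (inj₂ (k , below , 0<fk)) = inj₁ (inj₂ (suc k , (λ where
        zero    _           → sym 0≡f₀
        (suc j) (ℕ.s≤s j<k) → below j j<k) , 0<fk))
... | inj₂ (k , below , 0<-fk) = inj₂ (suc k , (λ where
        zero    _           → cong -_ (sym 0≡f₀)
        (suc j) (ℕ.s≤s j<k) → below j j<k) , 0<-fk)

-- Multiplication of a power series in ε by the discount factor 1 − ε.
disc : Series → Series
disc f zero    = f zero
disc f (suc k) = f (suc k) - f k

disc-cong : ∀ {f g} → f ≗ g → disc f ≗ disc g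
disc-cong f≗g zero    = f≗g zero
disc-cong f≗g (suc k) = cong₂ _-_ (f≗g (suc k)) (f≗g k)

disc-⊞ : ∀ f g → disc (f ⊞ g) ≗ disc f ⊞ disc g
disc-⊞ f g zero    = refl
disc-⊞ f g (suc k) = identity (f (suc k)) (g (suc k)) (f k) (g k)
  where
  identity : ∀ a b c d → a + b - (c + d) ≡ a - c + (b - d)
  identity = solve-∀

disc-⊟ : ∀ f g → disc (f ⊟ g) ≗ disc f ⊟ disc g
disc-⊟ f g zero    = refl
disc-⊟ f g (suc k) = identity (f (suc k)) (g (suc k)) (f k) (g k)
  where
  identity : ∀ a b c d → a - b - (c - d) ≡ a - c - (b - d)
  identity = solve-∀

disc-NonNeg : ∀ {f} → NonNeg f → NonNeg (disc f)
disc-NonNeg (inj₁ f≗0) = inj₁ λ where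
  zero    → f≗0 zero
  (suc k) → cong₂ _-_ (f≗0 (suc k)) (f≗0 k)
disc-NonNeg {f} (inj₂ (k , below , 0<fk)) = inj₂ (k , below′ , leading k below 0<fk)
  where
  below′ : ∀ j → j ℕ.< k → disc f j ≡ 0ℤ
  below′ zero    j<k = below zero j<k
  below′ (suc j) j<k = cong₂ _-_ (below (suc j) j<k) (below j (ℕ.<-trans (ℕ.n<1+n j) j<k))
  leading : ∀ k → (∀ j → j ℕ.< k → f j ≡ 0ℤ) → 0ℤ < f k → 0ℤ < disc f k
  leading zero    _     0<f₀ = 0<f₀
  leading (suc k) below 0<f  =
    subst (0ℤ <_) (sym (trans (cong (λ x → f (suc k) - x) (below k (ℕ.n<1+n k))) (+-identityʳ _))) 0<f

-- `f ⊟ disc f` is ε f, the shift of `f` by one place.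
Pos⇒Pos-⊟-disc : ∀ {f} → Pos f → Pos (f ⊟ disc f)
Pos⇒Pos-⊟-disc {f} (k , below , 0<fk) =
  suc k , below′ , subst (0ℤ <_) (sym (identity (f (suc k)) (f k))) 0<fk
  where
  identity : ∀ a b → a - (a - b) ≡ b
  identity = solve-∀
  below′ : ∀ j → j ℕ.< suc k → (f ⊟ disc f) j ≡ 0ℤ
  below′ zero    _           = i≡j⇒i-j≡0 {f 0} refl
  below′ (suc j) (ℕ.s≤s j<k) = trans (identity (f (suc j)) (f j)) (below j j<k)

⊟-FinDeg : ∀ {f g} → FinDeg f → FinDeg g → FinDeg (f ⊟ g)
⊟-FinDeg (d , f≡0) (e , g≡0) = d ℕ.⊔ e , λ k d⊔e≤k →
  cong₂ _-_ (f≡0 k (ℕ.m⊔n≤o⇒m≤o d e d⊔e≤k)) (g≡0 k (ℕ.m⊔n≤o⇒n≤o d e d⊔e≤k))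

⊞-FinDeg : ∀ {f g} → FinDeg f → FinDeg g → FinDeg (f ⊞ g)
⊞-FinDeg (d , f≡0) (e , g≡0) = d ℕ.⊔ e , λ k d⊔e≤k →
  cong₂ _+_ (f≡0 k (ℕ.m⊔n≤o⇒m≤o d e d⊔e≤k)) (g≡0 k (ℕ.m⊔n≤o⇒n≤o d e d⊔e≤k))

disc-FinDeg : ∀ {f} → FinDeg f → FinDeg (disc f)
disc-FinDeg (d , f≡0) = suc d , λ where
  (suc k) (ℕ.s≤s d≤k) → cong₂ _-_ (f≡0 (suc k) (ℕ.m≤n⇒m≤1+n d≤k)) (f≡0 k d≤k)

constant-FinDeg : ∀ c → FinDeg (constant c)
constant-FinDeg c = 1 , λ where (suc k) _ → refl

discⁿ : ℕ → Series → Series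
discⁿ zero    f = f
discⁿ (suc k) f = disc (discⁿ k f)

discⁿ-cong : ∀ k {f g} → f ≗ g → discⁿ k f ≗ discⁿ k g
discⁿ-cong zero    f≗g = f≗g
discⁿ-cong (suc k) f≗g = disc-cong (discⁿ-cong k f≗g)

discⁿ-⊞ : ∀ k f g → discⁿ k (f ⊞ g) ≗ discⁿ k f ⊞ discⁿ k g
discⁿ-⊞ zero    f g j = refl
discⁿ-⊞ (suc k) f g j = trans (disc-cong (discⁿ-⊞ k f g) j) (disc-⊞ (discⁿ k f) (discⁿ k g) j)

discⁿ-disc : ∀ k f → discⁿ k (disc f) ≡ disc (discⁿ k f)
discⁿ-disc zero    f = refl
discⁿ-disc (suc k) f = cong disc (discⁿ-disc k f)

discⁿ-+ : ∀ k l f → discⁿ (k ℕ.+ l) f ≡ discⁿ k (discⁿ l f)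
discⁿ-+ zero    l f = refl
discⁿ-+ (suc k) l f = cong disc (discⁿ-+ k l f)

discⁿ-FinDeg : ∀ k {f} → FinDeg f → FinDeg (discⁿ k f)
discⁿ-FinDeg zero    fin = fin
discⁿ-FinDeg (suc k) fin = disc-FinDeg (discⁿ-FinDeg k fin)

-- Eventual periodicity of iterated maps on a finite set.

module _ {A : Set} (f : A → A) where

  iter : ℕ → A → A
  iter zero    x = x
  iter (suc k) x = iter k (f x)

  iter-+ : ∀ k l x → iter (k ℕ.+ l) x ≡ iter l (iter k x)
  iter-+ zero    l x = refl
  iter-+ (suc k) l x = iter-+ k l (f x)

  iter-period : ∀ i p x → iter (i ℕ.+ p) x ≡ iter i x →
                ∀ q d → iter (i ℕ.+ (q ℕ.* p ℕ.+ d)) x ≡ iter (i ℕ.+ d) x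
  iter-period i p x eq zero    d = refl
  iter-period i p x eq (suc q) d = begin
    iter (i ℕ.+ (p ℕ.+ q ℕ.* p ℕ.+ d)) x
      ≡⟨ cong (λ l → iter l x)
              (trans (cong (i ℕ.+_) (ℕ.+-assoc p _ d)) (sym (ℕ.+-assoc i p _))) ⟩
    iter (i ℕ.+ p ℕ.+ (q ℕ.* p ℕ.+ d)) x     ≡⟨ iter-+ (i ℕ.+ p) _ x ⟩
    iter (q ℕ.* p ℕ.+ d) (iter (i ℕ.+ p) x)  ≡⟨ cong (iter (q ℕ.* p ℕ.+ d)) eq ⟩
    iter (q ℕ.* p ℕ.+ d) (iter i x)          ≡⟨ iter-+ i _ x ⟨
    iter (i ℕ.+ (q ℕ.* p ℕ.+ d)) x           ≡⟨ iter-period i p x eq q d ⟩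
    iter (i ℕ.+ d) x                         ∎
    where open ≡-Reasoning

suc∣! : ∀ p n → suc p ℕ.≤ n → suc p ∣ n !
suc∣! p n p<n = ∣-trans (m∣m*n (p !)) (m≤n⇒m!∣n! p<n)

-- The n-th iterate already lies on the cycle. The cycle length `suc d` is at most n and so divides
-- `n !`, hence `n !` further steps go around a whole number of times.
iter-eventually-periodic : ∀ {A : Set} (f : A → A) x n i d → i ℕ.+ suc d ℕ.≤ n →
  iter f (i ℕ.+ suc d) x ≡ iter f i x → iter f (n ! ℕ.+ n) x ≡ iter f n x
iter-eventually-periodic f x n i d i+p≤n eq
  with divides q n!≡q*p ← suc∣! d n (ℕ.≤-trans (ℕ.m≤n+m (suc d) i) i+p≤n)
  with e , refl ← ℕ.m≤n⇒∃[o]m+o≡n (ℕ.≤-trans (ℕ.m≤m+n i (suc d)) i+p≤n)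
  = trans (cong (λ l → iter f l x) (trans (cong (ℕ._+ (i ℕ.+ e)) n!≡q*p) (rearrange (q ℕ.* suc d) i e)))
          (iter-period f i (suc d) x eq q e)
  where
  rearrange : ∀ a b c → a ℕ.+ (b ℕ.+ c) ≡ b ℕ.+ (a ℕ.+ c)
  rearrange a b c = trans (sym (ℕ.+-assoc a b c))
    (trans (cong (ℕ._+ c) (ℕ.+-comm a b)) (ℕ.+-assoc b a c))

iter-! : ∀ {n} (f : Fin n → Fin n) s → iter f (n ! ℕ.+ n) s ≡ iter f n s
iter-! {n} f s
  with i , j , i<j , eq ← Fin.pigeonhole (ℕ.n<1+n n) (λ (i : Fin (suc n)) → iter f (toℕ i) s)
  with d , i+1+d≡j ← ℕ.m≤n⇒∃[o]m+o≡n i<j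
  = iter-eventually-periodic f s n (toℕ i) d
      (subst (ℕ._≤ n) (sym i+p≡j) (ℕ.s≤s⁻¹ (Fin.toℕ<n j)))
      (trans (cong (λ l → iter f l s) i+p≡j) (sym eq))
  where
  i+p≡j = trans (ℕ.+-suc (toℕ i) d) i+1+d≡j

-- Order lemmas for series and maxima of finite preorders.

⪯-trans : ∀ f g h → f ⪯ g → g ⪯ h → f ⪯ h
⪯-trans f g h f⪯g g⪯h =
  NonNeg-cong (λ k → identity (f k) (g k) (h k)) (NonNeg-⊞ f⪯g g⪯h)
  where
  identity : ∀ a b c → b - a + (c - b) ≡ c - a
  identity = solve-∀

⪯-total : ∀ f g → FinDeg f → FinDeg g → f ⪯ g ⊎ g ⪯ f
⪯-total f g finF finG with d , above ← ⊟-FinDeg finG finF | NonNeg⊎Pos (g ⊟ f) d above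
... | inj₁ f⪯g = inj₁ f⪯g
... | inj₂ g≺f = inj₂ (inj₂ (Pos-cong (λ k → neg-minus (g k) (f k)) g≺f))
  where
  neg-minus : ∀ a b → - (a - b) ≡ b - a
  neg-minus = solve-∀

-- g - (1 - ε) f = ε g + (1 - ε)(g - f), a sum of two nonnegative series.
disc-contracts : ∀ {f g} → NonNeg g → f ⪯ g → disc f ⪯ g
disc-contracts {f} {g} 0≤g f⪯g =
  NonNeg-cong (λ k → trans (cong (_+_ (g k - disc g k)) (disc-⊟ g f k)) (identity (g k) (disc g k) (disc f k)))
    (NonNeg-⊞ (g-disc-g 0≤g) (disc-NonNeg f⪯g))
  where
  identity : ∀ a b c → a - b + (b - c) ≡ a - c
  identity = solve-∀
  cancel : ∀ a b → a - (a - b) ≡ b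
  cancel = solve-∀
  g-disc-g : NonNeg g → NonNeg (g ⊟ disc g)
  g-disc-g (inj₂ 0<g) = inj₂ (Pos⇒Pos-⊟-disc 0<g)
  g-disc-g (inj₁ g≗0) = inj₁ λ where
    zero    → +-inverseʳ (g zero)
    (suc k) → trans (cancel (g (suc k)) (g k)) (g≗0 k)

greatest : ∀ {n} (_≲_ : Fin n → Fin n → Set) →
           (∀ {i j k} → i ≲ j → j ≲ k → i ≲ k) → (∀ i j → i ≲ j ⊎ j ≲ i) →
           Fin n → ∃ λ m → ∀ i → i ≲ m
greatest {suc zero}    _≲_ trs total _ = zero , λ where zero → [ id , id ]′ (total zero zero)
greatest {suc (suc n)} _≲_ trs total _
  with m , max ← greatest (λ i j → suc i ≲ suc j) trs (λ i j → total (suc i) (suc j)) zero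
  with total zero (suc m)
... | inj₁ 0≲m = suc m , λ where
        zero    → 0≲m
        (suc i) → max i
... | inj₂ m≲0 = zero , λ where
        zero    → [ id , id ]′ (total zero zero)
        (suc i) → trs (max i) m≲0

P1≢P2 : ∀ {p} → p ≡ P1 → p ≢ P2
P1≢P2 refl ()

disc-0 : disc (constant 0ℤ) ≗ constant 0ℤ
disc-0 zero          = refl
disc-0 (suc zero)    = refl
disc-0 (suc (suc k)) = refl

-- Optimality equations of the discounted game.

module DiscountedGame {n : ℕ} (owner : Fin n → Player) (w : Fin n → Fin n → ℤ) where

  -- The weights are multiplied by 1 − (1 − ε)^(n!), a common denominator of the
  -- values of all games on n states, so that the scaled values are polynomials.
  scaled : ℤ → Series
  scaled c = constant c ⊟ discⁿ (n !) (constant c)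

  back : (Fin n → Series) → Fin n → Fin n → Series
  back X s s′ = scaled (w s s′) ⊞ disc (X s′)

  -- The moves form an arbitrary relation `A`, since the induction passes through subgames. The
  -- single map `best` holds an optimal choice for both players.
  record Solution (A : Fin n → Fin n → Set) : Set where
    field
      X      : Fin n → Series
      finDeg : ∀ s → FinDeg (X s)
      best   : Fin n → Fin n
      legal  : ∀ s → A s (best s)
      attain : ∀ s → X s ≗ back X s (best s)
      min    : ∀ {s s′} → owner s ≡ P1 → A s s′ → X s ⪯ back X s s′
      max    : ∀ {s s′} → owner s ≡ P2 → A s s′ → back X s s′ ⪯ X s

  open Solution

  Solution-resp : ∀ {A B : Fin n → Fin n → Set} → (∀ {s s′} → A s s′ → B s s′) →
                  (∀ {s s′} → B s s′ → A s s′) → Solution A → Solution B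
  Solution-resp to from sol = record
    { X = X sol ; finDeg = finDeg sol ; best = best sol
    ; legal = λ s → to (legal sol s) ; attain = attain sol
    ; min = λ p b → min sol p (from b) ; max = λ p b → max sol p (from b) }

  module _ {A B : Fin n → Fin n → Set} (solA : Solution A) (solB : Solution B) (s : Fin n)
           (A⇒B : ∀ {u u′} → u ≢ s → A u u′ → B u u′)
           (B⇒A : ∀ {u u′} → u ≢ s → B u u′ → A u u′) where
    private
      D : Fin n → Series
      D u = X solB u ⊟ X solA u
      finD : ∀ i → FinDeg (D i)
      finD i = ⊟-FinDeg (finDeg solB i) (finDeg solA i)

    -- At a state of player 1 the best move of A is compared in both games, at a state of player 2
    -- that of B. It is exact in its own game and only bounds the value in the other; the scaled
    -- weights cancel in the difference.
    difference-⪯-disc : ∀ {u} → u ≢ s → ∃ λ u′ → D u ⪯ disc (D u′)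
    difference-⪯-disc {u} u≢s with owner u in owner-u
    ... | P1 = best solA u , NonNeg-cong
          (λ k → trans (identity (scaled (w u (best solA u)) k) (disc (X solB (best solA u)) k)
                                 (X solB u k) (disc (X solA (best solA u)) k) (X solA u k) (attain solA u k))
                       (cong (_- D u k) (sym (disc-⊟ (X solB (best solA u)) (X solA (best solA u)) k))))
          (min solB owner-u (A⇒B u≢s (legal solA u)))
          where
          identity : ∀ m b′ b a′ a → a ≡ m + a′ → m + b′ - b ≡ b′ - a′ - (b - a)
          identity m b′ b a′ _ refl = ring m b′ b a′
            where
            ring : ∀ m b′ b a′ → m + b′ - b ≡ b′ - a′ - (b - (m + a′))
            ring = solve-∀
    ... | P2 = best solB u , NonNeg-cong
          (λ k → trans (identity (scaled (w u (best solB u)) k) (disc (X solA (best solB u)) k)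
                                 (X solA u k) (disc (X solB (best solB u)) k) (X solB u k) (attain solB u k))
                       (cong (_- D u k) (sym (disc-⊟ (X solB (best solB u)) (X solA (best solB u)) k))))
          (max solA owner-u (B⇒A u≢s (legal solB u)))
          where
          identity : ∀ m a′ a b′ b → b ≡ m + b′ → a - (m + a′) ≡ b′ - a′ - (b - a)
          identity m a′ a b′ _ refl = ring m a′ a b′
            where
            ring : ∀ m a′ a b′ → a - (m + a′) ≡ b′ - a′ - (m + b′ - a)
            ring = solve-∀

    -- At a state u maximising D, unless u = s, D u ≤ (1 − ε) D u′ ≤ (1 − ε) D u,
    -- which is impossible if D u > 0.
    difference-⪯ : X solA s ⪯ X solB s → ∀ u → D u ⪯ D s
    difference-⪯ 0≤Ds v
      with u , D≤Du ← greatest (λ i j → D i ⪯ D j) (λ {i} {j} {k} → ⪯-trans (D i) (D j) (D k))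
                               (λ i j → ⪯-total (D i) (D j) (finD i) (finD j)) s
      = conclude u D≤Du
      where
      conclude : ∀ u → (∀ i → D i ⪯ D u) → D v ⪯ D s
      conclude u D≤Du
        with d , above ← ⊟-FinDeg (finD s) (finD u) | NonNeg⊎Pos (D s ⊟ D u) d above
      ... | inj₁ Du≤Ds = ⪯-trans (D v) (D u) (D s) (D≤Du v) Du≤Ds
      ... | inj₂ Ds<Du = ⊥-elim contradictory
        where
        cancel : ∀ a b → - (a - b) + a ≡ b
        cancel = solve-∀
        u≢s : u ≢ s
        u≢s refl = Vanishing⇒¬Pos (λ k → cong -_ (+-inverseʳ (D u k))) Ds<Du
        0<Du : Pos (D u)
        0<Du = Pos-cong (λ k → cancel (D s k) (D u k)) (Pos-⊞ Ds<Du 0≤Ds)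
        sums-to-0 : ∀ a b c → a - b + (b - c) + (c - a) ≡ 0ℤ
        sums-to-0 = solve-∀
        contradictory : ⊥
        -- The series ε D u, (1 - ε)(D u - D u′) and (1 - ε) D u′ - D u add up to 0, but the first
        -- is positive and the others are nonnegative.
        contradictory with u′ , Du≤discDu′ ← difference-⪯-disc u≢s =
          Vanishing⇒¬Pos
            (λ k → trans (cong (λ x → D u k - disc (D u) k + x + (disc (D u′) k - D u k)) (disc-⊟ (D u) (D u′) k))
                         (sums-to-0 (D u k) (disc (D u) k) (disc (D u′) k)))
            (Pos-⊞ (Pos-⊞ (Pos⇒Pos-⊟-disc 0<Du) (disc-NonNeg (D≤Du u′))) Du≤discDu′)

  module _ {A B C : Fin n → Fin n → Set} (solA : Solution A) (solB : Solution B) (s : Fin n)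
           (A⇒B : ∀ {u u′} → u ≢ s → A u u′ → B u u′)
           (B⇒A : ∀ {u u′} → u ≢ s → B u u′ → A u u′)
           (A⇒C : ∀ {u u′} → A u u′ → C u u′)
           (C⇒A⊎B : ∀ {u u′} → C u u′ → A u u′ ⊎ u ≡ s × B u u′) where

    -- A further move of `C` at `s` is a move of B. Its slack for `X solA` is its slack for `X solB`
    -- plus D s - (1 - ε) D u′, where D is the owner's loss in passing from A to B: at `s` it is
    -- nonnegative and largest.
    extend : (owner s ≡ P1 → X solA s ⪯ X solB s) → (owner s ≡ P2 → X solB s ⪯ X solA s) → Solution C
    extend better₁ better₂ = record
      { X = X solA ; finDeg = finDeg solA ; best = best solA
      ; legal = A⇒C ∘ legal solA ; attain = attain solA ; min = minC ; max = maxC }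
      where
      minC : ∀ {u u′} → owner u ≡ P1 → C u u′ → X solA u ⪯ back (X solA) u u′
      minC {u} {u′} p c with C⇒A⊎B c
      ... | inj₁ a          = min solA p a
      ... | inj₂ (refl , b) = NonNeg-cong
        (λ k → trans (cong (λ x → back (X solB) s u′ k - X solB s k + (X solB s k - X solA s k - x))
                           (disc-⊟ (X solB u′) (X solA u′) k))
                     (identity (scaled (w s u′) k) (disc (X solB u′) k) (X solB s k)
                               (X solA s k) (disc (X solA u′) k)))
        (NonNeg-⊞ (min solB p b)
          (disc-contracts (better₁ p) (difference-⪯ solA solB s A⇒B B⇒A (better₁ p) u′)))
        where
        identity : ∀ m b′ b a a′ → m + b′ - b + (b - a - (b′ - a′)) ≡ m + a′ - a
        identity = solve-∀
      maxC : ∀ {u u′} → owner u ≡ P2 → C u u′ → back (X solA) u u′ ⪯ X solA u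
      maxC {u} {u′} p c with C⇒A⊎B c
      ... | inj₁ a          = max solA p a
      ... | inj₂ (refl , b) = NonNeg-cong
        (λ k → trans (cong (λ x → X solB s k - back (X solB) s u′ k + (X solA s k - X solB s k - x))
                           (disc-⊟ (X solA u′) (X solB u′) k))
                     (identity (scaled (w s u′) k) (disc (X solB u′) k) (X solB s k)
                               (X solA s k) (disc (X solA u′) k)))
        (NonNeg-⊞ (max solB p b)
          (disc-contracts (better₂ p) (difference-⪯ solB solA s B⇒A A⇒B (better₂ p) u′)))
        where
        identity : ∀ m b′ b a a′ → b - (m + b′) + (a - b - (a′ - b′)) ≡ a - (m + a′)
        identity = solve-∀

  combine : ∀ {A B C : Fin n → Fin n → Set} → Solution A → Solution B → (s : Fin n) →
            (∀ {u u′} → u ≢ s → A u u′ → B u u′) → (∀ {u u′} → u ≢ s → B u u′ → A u u′) →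
            (∀ {u u′} → A u u′ → C u u′) → (∀ {u u′} → B u u′ → C u u′) →
            (∀ {u u′} → C u u′ → A u u′ ⊎ u ≡ s × B u u′) →
            (∀ {u u′} → C u u′ → B u u′ ⊎ u ≡ s × A u u′) → Solution C
  combine solA solB s A⇒B B⇒A A⇒C B⇒C C⇒A⊎B C⇒B⊎A
    with owner s in owner-s | ⪯-total (X solA s) (X solB s) (finDeg solA s) (finDeg solB s)
  ... | P1 | inj₁ A⪯B = extend solA solB s A⇒B B⇒A A⇒C C⇒A⊎B (λ _ → A⪯B) (⊥-elim ∘ P1≢P2 owner-s)
  ... | P1 | inj₂ B⪯A = extend solB solA s B⇒A A⇒B B⇒C C⇒B⊎A (λ _ → B⪯A) (⊥-elim ∘ P1≢P2 owner-s)
  ... | P2 | inj₁ A⪯B = extend solB solA s B⇒A A⇒B B⇒C C⇒B⊎A (λ p → ⊥-elim (P1≢P2 p owner-s)) (λ _ → A⪯B)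
  ... | P2 | inj₂ B⪯A = extend solA solB s A⇒B B⇒A A⇒C C⇒A⊎B (λ p → ⊥-elim (P1≢P2 p owner-s)) (λ _ → B⪯A)

  -- Games with a single move at every state.

  module OneChoice (f : Fin n → Fin n) where

    reward : Fin n → Series
    reward s = constant (w s (f s))

    prefix : ℕ → Fin n → Series
    prefix zero    s = constant 0ℤ
    prefix (suc k) s = reward s ⊞ disc (prefix k (f s))

    -- The definition peels off the first reward; periodicity concerns the last one, so the sum is
    -- also split at its far end.
    prefix-suc : ∀ k s → prefix (suc k) s ≗ prefix k s ⊞ discⁿ k (reward (iter f k s))
    prefix-suc zero    s j = trans (cong (_+_ (reward s j)) (disc-0 j)) (+-comm (reward s j) (constant 0ℤ j))
    prefix-suc (suc k) s j =
      trans (cong (_+_ (reward s j))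
              (trans (disc-cong (prefix-suc k (f s)) j) (disc-⊞ (prefix k (f s)) (discⁿ k (reward (iter f k (f s)))) j)))
            (sym (+-assoc (reward s j) _ _))

    -- Let V be the infinite discounted sum along the path. The path has period `n !` from step n
    -- on, so in V - (1 - ε)^(n!) V the tail after n! + n steps cancels against the tail after n
    -- steps, leaving these two finite sums.
    value : Fin n → Series
    value s = prefix (n ! ℕ.+ n) s ⊟ discⁿ (n !) (prefix n s)

    value-attain : ∀ s → value s ≗ back value s (f s)
    value-attain s j = trans
      (identity (reward s j) (disc (prefix (n ! ℕ.+ n) (f s)) j) (prefix (n ! ℕ.+ n) s j)
                (discⁿ (n !) (reward s) j) (disc (discⁿ (n !) (prefix n (f s))) j) (discⁿ (n !) (prefix n s) j)
                (discⁿ (n !) (discⁿ n (reward (iter f n s))) j) long short)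
      (cong (_+_ (scaled (w s (f s)) j)) (sym (disc-⊟ (prefix (n ! ℕ.+ n) (f s)) _ j)))
      where
      open ≡-Reasoning
      -- Lengthening either truncated sum by one step adds the same term, because the rewards after
      -- n and after n! + n steps agree; it cancels in the difference.
      long : reward s j + disc (prefix (n ! ℕ.+ n) (f s)) j ≡
             prefix (n ! ℕ.+ n) s j + discⁿ (n !) (discⁿ n (reward (iter f n s))) j
      long = trans (prefix-suc (n ! ℕ.+ n) s j)
        (cong (λ x → prefix (n ! ℕ.+ n) s j + x j)
          (trans (cong (discⁿ (n ! ℕ.+ n) ∘ reward) (iter-! f s)) (discⁿ-+ (n !) n _)))
      short : discⁿ (n !) (reward s) j + disc (discⁿ (n !) (prefix n (f s))) j ≡
              discⁿ (n !) (prefix n s) j + discⁿ (n !) (discⁿ n (reward (iter f n s))) j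
      short = begin
        discⁿ (n !) (reward s) j + disc (discⁿ (n !) (prefix n (f s))) j
          ≡⟨ cong (λ x → discⁿ (n !) (reward s) j + x j) (discⁿ-disc (n !) (prefix n (f s))) ⟨
        discⁿ (n !) (reward s) j + discⁿ (n !) (disc (prefix n (f s))) j
          ≡⟨ discⁿ-⊞ (n !) (reward s) (disc (prefix n (f s))) j ⟨
        discⁿ (n !) (prefix (suc n) s) j
          ≡⟨ discⁿ-cong (n !) (prefix-suc n s) j ⟩
        discⁿ (n !) (prefix n s ⊞ discⁿ n (reward (iter f n s))) j
          ≡⟨ discⁿ-⊞ (n !) (prefix n s) (discⁿ n (reward (iter f n s))) j ⟩
        discⁿ (n !) (prefix n s) j + discⁿ (n !) (discⁿ n (reward (iter f n s))) j ∎
      identity : ∀ r dL pL qr dq q t → r + dL ≡ pL + t → qr + dq ≡ q + t →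
                 pL - q ≡ r - qr + (dL - dq)
      identity r dL pL qr dq q t eqL eqq =
        trans (ring₁ pL q t) (trans (cong₂ _-_ (sym eqL) (sym eqq)) (ring₂ r dL qr dq))
        where
        ring₁ : ∀ pL q t → pL - q ≡ pL + t - (q + t)
        ring₁ = solve-∀
        ring₂ : ∀ r dL qr dq → r + dL - (qr + dq) ≡ r - qr + (dL - dq)
        ring₂ = solve-∀

    prefix-FinDeg : ∀ k s → FinDeg (prefix k s)
    prefix-FinDeg zero    s = constant-FinDeg 0ℤ
    prefix-FinDeg (suc k) s = ⊞-FinDeg (constant-FinDeg _) (disc-FinDeg (prefix-FinDeg k (f s)))

    solution : Solution (λ s s′ → s′ ≡ f s)
    solution = record
      { X = value
      ; finDeg = λ s → ⊟-FinDeg (prefix-FinDeg (n ! ℕ.+ n) s) (discⁿ-FinDeg (n !) (prefix-FinDeg n s))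
      ; best = f ; legal = λ _ → refl ; attain = value-attain
      ; min = λ {s} → λ where _ refl → inj₁ λ k → i≡j⇒i-j≡0 (sym (value-attain s k))
      ; max = λ {s} → λ where _ refl → inj₁ λ k → i≡j⇒i-j≡0 (value-attain s k)
      }

  -- Solving games by induction on the available moves.

  -- The default move `f s` keeps every subgame total; `E s` lists further moves.
  Arena : (Fin n → Fin n) → (Fin n → List (Fin n)) → Fin n → Fin n → Set
  Arena f E s s′ = s′ ≡ f s ⊎ s′ ∈ E s

  -- Outer induction on `l`, which contains all states that may still have listed moves; inner
  -- induction, in `restrict`, on the moves listed at the head `a`.
  solve : ∀ (l : List (Fin n)) f E → (∀ s → s ∈ l ⊎ E s ≡ []) → Solution (Arena f E)
  solve []      f E single = Solution-resp inj₁ only-f (OneChoice.solution f)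
    where
    only-f : ∀ {s s′} → Arena f E s s′ → s′ ≡ f s
    only-f (inj₁ s′≡fs) = s′≡fs
    only-f {s} {s′} (inj₂ s′∈Es) with inj₂ Es≡[] ← single s with () ← subst (s′ ∈_) Es≡[] s′∈Es
  solve (a ∷ l) f E single = Solution-resp restored removed (restrict (E a) f)
    where
    E[_] : List (Fin n) → Fin n → List (Fin n)
    E[ t ] = updateAt E a (λ _ → t)

    off : ∀ f f′ t t′ {u u′} → u ≢ a → f u ≡ f′ u → Arena f E[ t ] u u′ → Arena f′ E[ t′ ] u u′
    off f f′ t t′ u≢a fu≡f′u (inj₁ u′≡fu) = inj₁ (trans u′≡fu fu≡f′u)
    off f f′ t t′ {u} {u′} u≢a fu≡f′u (inj₂ u′∈E) = inj₂ (subst (u′ ∈_)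
      (trans (updateAt-minimal u a E u≢a) (sym (updateAt-minimal u a E u≢a))) u′∈E)

    at : ∀ f {t u′} → Arena f E[ t ] a u′ → u′ ≡ f a ⊎ u′ ∈ t
    at f {u′ = u′} = Sum.map₂ (subst (u′ ∈_) (updateAt-updates a E))

    at⁻¹ : ∀ f {t u′} → u′ ≡ f a ⊎ u′ ∈ t → Arena f E[ t ] a u′
    at⁻¹ f {u′ = u′} = Sum.map₂ (subst (u′ ∈_) (sym (updateAt-updates a E)))

    restored : ∀ {u u′} → Arena f E[ E a ] u u′ → Arena f E u u′
    restored {u} {u′} = Sum.map₂ (subst (u′ ∈_) (updateAt-id-local a E refl u))

    removed : ∀ {u u′} → Arena f E u u′ → Arena f E[ E a ] u u′
    removed {u} {u′} = Sum.map₂ (subst (u′ ∈_) (sym (updateAt-id-local a E refl u)))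

    restrict-[] : ∀ f → Solution (Arena f E[ [] ])
    restrict-[] f = solve l f E[ [] ] single′
      where
      single′ : ∀ s → s ∈ l ⊎ E[ [] ] s ≡ []
      single′ s with s Fin.≟ a
      ... | yes refl = inj₂ (updateAt-updates s E)
      ... | no  s≢a with single s
      ...   | inj₁ (here s≡a)  = ⊥-elim (s≢a s≡a)
      ...   | inj₁ (there s∈l) = inj₁ s∈l
      ...   | inj₂ Es≡[]       = inj₂ (trans (updateAt-minimal s a E s≢a) Es≡[])

    restrict : ∀ t f → Solution (Arena f E[ t ])
    restrict []      f = restrict-[] f
    restrict (b ∷ t) f =
      -- The moves at `a` split into the default `f a` alone and the listed ones, among which `b` is
      -- promoted to default so that the state keeps a move.
      combine (restrict-[] f) (restrict t f′) a
        (λ u≢a → off f f′ [] t u≢a (f≡f′ u≢a)) (λ u≢a → off f′ f t [] u≢a (sym (f≡f′ u≢a)))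
        A⇒C B⇒C C⇒A⊎B C⇒B⊎A
      where
      f′ : Fin n → Fin n
      f′ = updateAt f a (λ _ → b)
      f′a≡b : f′ a ≡ b
      f′a≡b = updateAt-updates a f
      f≡f′ : ∀ {u} → u ≢ a → f u ≡ f′ u
      f≡f′ {u} u≢a = sym (updateAt-minimal u a f u≢a)
      A⇒C : ∀ {u u′} → Arena f E[ [] ] u u′ → Arena f E[ b ∷ t ] u u′
      A⇒C {u} e with u Fin.≟ a
      ... | no  u≢a  = off f f [] (b ∷ t) u≢a refl e
      ... | yes refl = at⁻¹ f (Sum.map₂ (λ ()) (at f e))
      B⇒C : ∀ {u u′} → Arena f′ E[ t ] u u′ → Arena f E[ b ∷ t ] u u′
      B⇒C {u} e with u Fin.≟ a
      ... | no  u≢a  = off f′ f t (b ∷ t) u≢a (sym (f≡f′ u≢a)) e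
      ... | yes refl with at f′ e
      ...   | inj₁ u′≡f′a = at⁻¹ f (inj₂ (here (trans u′≡f′a f′a≡b)))
      ...   | inj₂ u′∈t   = at⁻¹ f (inj₂ (there u′∈t))
      C⇒A⊎B : ∀ {u u′} → Arena f E[ b ∷ t ] u u′ → Arena f E[ [] ] u u′ ⊎ u ≡ a × Arena f′ E[ t ] u u′
      C⇒A⊎B {u} e with u Fin.≟ a
      ... | no  u≢a  = inj₁ (off f f (b ∷ t) [] u≢a refl e)
      ... | yes refl with at f e
      ...   | inj₁ u′≡fa         = inj₁ (inj₁ u′≡fa)
      ...   | inj₂ (here u′≡b)   = inj₂ (refl , inj₁ (trans u′≡b (sym f′a≡b)))
      ...   | inj₂ (there u′∈t)  = inj₂ (refl , at⁻¹ f′ (inj₂ u′∈t))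
      C⇒B⊎A : ∀ {u u′} → Arena f E[ b ∷ t ] u u′ → Arena f′ E[ t ] u u′ ⊎ u ≡ a × Arena f E[ [] ] u u′
      C⇒B⊎A {u} e with u Fin.≟ a
      ... | no  u≢a  = inj₁ (off f f′ (b ∷ t) t u≢a (f≡f′ u≢a) e)
      ... | yes refl with C⇒A⊎B e
      ...   | inj₁ e′       = inj₂ (refl , e′)
      ...   | inj₂ (_ , e′) = inj₁ e′

-- Integer inequalities and truncated lexicographic signs.

0≤-+ : ∀ {a b} → 0ℤ ≤ a → 0ℤ ≤ b → 0ℤ ≤ a + b
0≤-+ = +-mono-≤

0≤-* : ∀ {a b} → 0ℤ ≤ a → 0ℤ ≤ b → 0ℤ ≤ a * b
0≤-* {+ a} {+ b} _ _ = subst (0ℤ ≤_) (pos-* a b) (+≤+ ℕ.z≤n)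

0≤-square : ∀ a → 0ℤ ≤ a * a
0≤-square (+ a)    = 0≤-* {+ a} {+ a} (+≤+ ℕ.z≤n) (+≤+ ℕ.z≤n)
0≤-square -[1+ a ] = +≤+ ℕ.z≤n

0≤+ : ∀ {n} → 0ℤ ≤ + n
0≤+ = +≤+ ℕ.z≤n

≤-by-difference : ∀ {a b d} → 0ℤ ≤ d → b - a ≡ d → a ≤ b
≤-by-difference 0≤d b-a≡d = 0≤i-j⇒j≤i (subst (0ℤ ≤_) (sym b-a≡d) 0≤d)

i≤∣i∣ : ∀ i → i ≤ + ∣ i ∣
i≤∣i∣ (+ _)    = ≤-refl
i≤∣i∣ -[1+ _ ] = -≤+

bounded : ∀ {n} (f : Fin n → ℤ) → ∃ λ b → ∀ s → f s ≤ + b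
bounded {zero}  f = 0 , λ ()
bounded {suc n} f with b , f≤b ← bounded (f ∘ suc) = ∣ f zero ∣ ℕ.+ b , λ where
    zero    → ≤-trans (i≤∣i∣ (f zero)) (+≤+ (ℕ.m≤m+n _ b))
    (suc s) → ≤-trans (f≤b s) (+≤+ (ℕ.m≤n+m b _))

bounded₂ : ∀ {n} (f : Fin n → Fin n → ℤ) → ∃ λ b → ∀ s s′ → f s s′ ≤ + b
bounded₂ f with b , rows≤b ← bounded (λ s → + proj₁ (bounded (f s))) =
  b , λ s s′ → ≤-trans (proj₂ (bounded (f s)) s′) (rows≤b s)

-- The last comparison is weak because coefficients beyond ε² are discarded.
Lex : ℤ → ℤ → ℤ → Set
Lex a b c = 0ℤ < a ⊎ a ≡ 0ℤ × (0ℤ < b ⊎ b ≡ 0ℤ × 0ℤ ≤ c)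

NonNeg⇒Lex : ∀ {f} → NonNeg f → Lex (f 0) (f 1) (f 2)
NonNeg⇒Lex (inj₁ f≗0) = inj₂ (f≗0 0 , inj₂ (f≗0 1 , ≤-reflexive (sym (f≗0 2))))
NonNeg⇒Lex (inj₂ (0 , _ , 0<f₀)) = inj₁ 0<f₀
NonNeg⇒Lex (inj₂ (1 , f≡0 , 0<f₁)) = inj₂ (f≡0 0 (ℕ.s≤s ℕ.z≤n) , inj₁ 0<f₁)
NonNeg⇒Lex (inj₂ (2 , f≡0 , 0<f₂)) =
  inj₂ (f≡0 0 (ℕ.s≤s ℕ.z≤n) , inj₂ (f≡0 1 (ℕ.s≤s (ℕ.s≤s ℕ.z≤n)) , <⇒≤ 0<f₂))
NonNeg⇒Lex (inj₂ (suc (suc (suc k)) , f≡0 , _)) =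
  inj₂ (f≡0 0 (ℕ.s≤s ℕ.z≤n) , inj₂ (f≡0 1 (ℕ.s≤s (ℕ.s≤s ℕ.z≤n)) ,
    ≤-reflexive (sym (f≡0 2 (ℕ.s≤s (ℕ.s≤s (ℕ.s≤s ℕ.z≤n)))))))

Lex⇒0≤ : ∀ {a b c} → Lex a b c → 0ℤ ≤ a
Lex⇒0≤ (inj₁ 0<a)        = <⇒≤ 0<a
Lex⇒0≤ (inj₂ (refl , _)) = ≤-refl

-- A positive integer `a` is at least 1, so (1 + R) a exceeds R and outweighs -b ≤ R.
Lex-merge : ∀ {a b c} R → - b ≤ + R → Lex a b c →
            0ℤ < (1ℤ + + R) * a + b ⊎ (1ℤ + + R) * a + b ≡ 0ℤ × 0ℤ ≤ c
Lex-merge {a} {b} R -b≤R (inj₁ 0<a) = inj₁ (suc[i]≤j⇒i<j (≤-by-difference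
    (0≤-+ (0≤-* {1ℤ + + R} 0≤+ (i≤j⇒0≤j-i (i<j⇒suc[i]≤j 0<a))) (i≤j⇒0≤j-i -b≤R))
    (identity (+ R) a b)))
  where
  identity : ∀ R a b → (1ℤ + R) * a + b - (1ℤ + 0ℤ) ≡ (1ℤ + R) * (a - (1ℤ + 0ℤ)) + (R - - b)
  identity = solve-∀
Lex-merge {b = b} R _ (inj₂ (refl , rest)) rewrite *-zeroʳ (1ℤ + + R) | +-identityˡ b
  with rest
... | inj₁ 0<b         = inj₁ 0<b
... | inj₂ (b≡0 , 0≤c) = inj₂ (b≡0 , 0≤c)

absorb : ∀ {c d} R → - c ≤ + R → 0ℤ < d ⊎ d ≡ 0ℤ × 0ℤ ≤ c → 0ℤ ≤ d × 0ℤ ≤ c + + R * d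
absorb {c} {d} R -c≤R (inj₁ 0<d) = <⇒≤ 0<d , subst (0ℤ ≤_) (sym (identity c d (+ R)))
    (0≤-+ (i≤j⇒0≤j-i -c≤R) (0≤-* {+ R} 0≤+ (i≤j⇒0≤j-i (i<j⇒suc[i]≤j 0<d))))
  where
  identity : ∀ c d R → c + R * d ≡ R - - c + R * (d - (1ℤ + 0ℤ))
  identity = solve-∀
absorb {c} R _ (inj₂ (refl , 0≤c)) =
  ≤-refl , subst (0ℤ ≤_) (sym (trans (cong (_+_ c) (*-zeroʳ (+ R))) (+-identityʳ c))) 0≤c

runningSum : (ℕ → ℤ) → ℕ → ℤ
runningSum E zero    = 0ℤ
runningSum E (suc m) = runningSum E m + E (suc m)

runningSum-nonneg : ∀ {E} → (∀ k → 0ℤ ≤ E k) → ∀ m → 0ℤ ≤ runningSum E m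
runningSum-nonneg 0≤E zero    = ≤-refl
runningSum-nonneg 0≤E (suc m) = 0≤-+ (runningSum-nonneg 0≤E m) (0≤E (suc m))

-- A nonnegative sequence with bounded increments is dominated by its own partial sums:
-- a large current value is preceded by many values that are almost as large.
multiple≤runningSum : ∀ E Q → E 0 ≡ 0ℤ → (∀ k → 0ℤ ≤ E k) → (∀ k → E (suc k) - E k ≤ + Q) →
                      ∀ t → ∃ λ K → ∀ m → + t * E m ≤ runningSum E m + + K
multiple≤runningSum E Q E₀≡0 0≤E step zero = 0 , λ m →
  ≤-trans (≤-reflexive (*-zeroˡ (E m))) (0≤-+ (runningSum-nonneg 0≤E m) ≤-refl)
multiple≤runningSum E Q E₀≡0 0≤E step (suc t)
  -- One copy of E (m + 1) is the new summand; the other t copies are at most t (E m + Q), which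
  -- costs t Q in the constant.
  with K , ih ← multiple≤runningSum E Q E₀≡0 0≤E step t = K ℕ.+ t ℕ.* Q , λ where
    zero    → ≤-trans (≤-reflexive (trans (cong (_*_ (+ suc t)) E₀≡0) (*-zeroʳ (+ suc t)))) 0≤+
    (suc m) → ≤-by-difference
      (0≤-+ (i≤j⇒0≤j-i (ih m)) (0≤-* {+ t} 0≤+ (i≤j⇒0≤j-i (step m))))
      (trans (cong (λ x → runningSum E m + E (suc m) + (+ K + x) - (1ℤ + + t) * E (suc m)) (pos-* t Q))
             (identity (runningSum E m) (E (suc m)) (E m) (+ K) (+ t) (+ Q)))
  where
  identity : ∀ S e′ e K t Q → S + e′ + (K + t * Q) - (1ℤ + t) * e′ ≡ S + K - t * e + t * (Q - (e′ - e))
  identity = solve-∀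

-- Potentials along a play and bounds on the sum of energy levels.

module _ (G : Game) where
  open Game G

  module _ (π : ℕ → Fin n) (P : ℕ) (y : Fin n → ℤ) where

    -- The slack of `y` as a potential for the weights times P. Along a play it telescopes to
    -- `total-excess`, so P EL(k) = y(π 0) - y(π k) - `total-excess k`.
    excess : Fin n → Fin n → ℤ
    excess s s′ = y s - y s′ - + P * w s s′

    total-excess : ℕ → ℤ
    total-excess k = y (π 0) - y (π k) - + P * EL G π k

    total-excess-0 : total-excess 0 ≡ 0ℤ
    total-excess-0 = identity (y (π 0)) (+ P)
      where
      identity : ∀ a P → a - a - P * 0ℤ ≡ 0ℤ
      identity = solve-∀

    total-excess-suc : ∀ k → total-excess (suc k) - total-excess k ≡ excess (π k) (π (suc k))
    total-excess-suc k =
      identity (y (π 0)) (y (π k)) (y (π (suc k))) (+ P) (EL G π k) (w (π k) (π (suc k)))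
      where
      identity : ∀ a b c P E w → a - c - P * (E + w) - (a - b - P * E) ≡ b - c - P * w
      identity = solve-∀

    module _ (excess-pos : ∀ i → 1ℤ ≤ excess (π i) (π (suc i))) where

      k≤total-excess : ∀ k → + k ≤ total-excess k
      k≤total-excess zero    = ≤-reflexive (sym total-excess-0)
      k≤total-excess (suc k) = ≤-by-difference
        (0≤-+ (i≤j⇒0≤j-i (k≤total-excess k))
              (i≤j⇒0≤j-i (subst (1ℤ ≤_) (sym (total-excess-suc k)) (excess-pos k))))
        (identity (total-excess (suc k)) (total-excess k) (+ k))
        where
        identity : ∀ E′ E k → E′ - (1ℤ + k) ≡ E - k + (E′ - E - 1ℤ)
        identity = solve-∀

      -- Excess at least 1 per step forces P EL(k) ≤ y(π 0) + b - k. Summation yields -m(m + 1)/2,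
      -- and the factor 2 clears the half.
      SumEL-quadratic : ∃ λ K → ∀ m →
        + 2 * (+ P * SumEL G π m) ≤ + 2 * (K * + m) - + m * + m - + m
      SumEL-quadratic with b , -y≤b ← bounded (-_ ∘ y) = y (π 0) + + b , go b -y≤b
        where
        go : ∀ b → (∀ s → - y s ≤ + b) → ∀ m →
             + 2 * (+ P * SumEL G π m) ≤ + 2 * ((y (π 0) + + b) * + m) - + m * + m - + m
        go b -y≤b zero = ≤-reflexive (identity (+ P) (y (π 0) + + b))
          where
          identity : ∀ P K → + 2 * (P * 0ℤ) ≡ + 2 * (K * 0ℤ) - 0ℤ * 0ℤ - 0ℤ
          identity = solve-∀
        go b -y≤b (suc m) = ≤-by-difference
          (0≤-+ (i≤j⇒0≤j-i (go b -y≤b m))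
                (0≤-* {+ 2} 0≤+ (0≤-+ (i≤j⇒0≤j-i (k≤total-excess (suc m)))
                                      (i≤j⇒0≤j-i (-y≤b (π (suc m)))))))
          (identity (+ P) (y (π 0)) (y (π (suc m))) (+ b) (+ m) (SumEL G π m) (EL G π (suc m)))
          where
          identity : ∀ P a c b m S E →
            + 2 * ((a + b) * (1ℤ + m)) - (1ℤ + m) * (1ℤ + m) - (1ℤ + m) - + 2 * (P * (S + E)) ≡
            + 2 * ((a + b) * m) - m * m - m - + 2 * (P * S) +
              + 2 * ((a - c - P * E - (1ℤ + m)) + (b - - c))
          identity = solve-∀

      SumEL-below : ∀ T → ∃ λ K → ∀ m → + 2 * + P * SumEL G π m ≤ + 2 * T * + m + K
      SumEL-below T with K , quadratic ← SumEL-quadratic =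
        -- Completing the square: 2 (K - T) m - m² ≤ (K - T)².
        (K - T) * (K - T) , λ m → ≤-by-difference
          (0≤-+ (i≤j⇒0≤j-i (quadratic m)) (0≤-+ (0≤-square (K - T - + m)) (0≤+ {m})))
          (identity K T (+ m) (+ P) (SumEL G π m))
        where
        identity : ∀ K T m P S → + 2 * T * m + (K - T) * (K - T) - + 2 * P * S ≡
                   + 2 * (K * m) - m * m - m - + 2 * (P * S) + ((K - T - m) * (K - T - m) + m)
        identity = solve-∀

    module _ (0<P : 0 ℕ.< P) (z : Fin n → ℤ) (t : ℕ)
             (excess-nonneg : ∀ i → 0ℤ ≤ excess (π i) (π (suc i)))
             (level : ∀ i → - (+ P * y (π (suc i))) ≤ z (π i) - z (π (suc i)) + + t * excess (π i) (π (suc i))) where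

      private E = total-excess

      E-nonneg : ∀ k → 0ℤ ≤ E k
      E-nonneg zero    = ≤-reflexive (sym total-excess-0)
      E-nonneg (suc k) = ≤-trans (E-nonneg k)
        (0≤i-j⇒j≤i (subst (0ℤ ≤_) (sym (total-excess-suc k)) (excess-nonneg k)))

      -- In the sum of P EL(i) = y(π 0) - y(π i) - E i, `level` bounds each -P y(π i) by a
      -- difference of `z`, which telescopes, plus a multiple of the excess, which sums to t E m.
      invariant : ∀ m → + P * (+ P * SumEL G π m) + z (π m) + + P * runningSum E m ≤
                        + P * y (π 0) * + m + z (π 0) + + t * E m
      invariant zero = ≤-reflexive (identity (+ P) (y (π 0)) (z (π 0)) (+ t))
        where
        identity : ∀ P a z t → P * (P * 0ℤ) + z + P * 0ℤ ≡ P * a * 0ℤ + z + t * (a - a - P * 0ℤ)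
        identity = solve-∀
      invariant (suc m) = ≤-by-difference
        (0≤-+ (i≤j⇒0≤j-i (invariant m)) (i≤j⇒0≤j-i (level m)))
        (identity (+ P) (+ t) (y (π 0)) (y (π m)) (y (π (suc m))) (z (π 0)) (z (π m)) (z (π (suc m)))
                  (+ m) (SumEL G π m) (EL G π m) (w (π m) (π (suc m))) (runningSum E m))
        where
        identity : ∀ P t a b c z₀ z z′ m S L w r →
          P * a * (1ℤ + m) + z₀ + t * (a - c - P * (L + w))
            - (P * (P * (S + (L + w))) + z′ + P * (r + (a - c - P * (L + w)))) ≡
          P * a * m + z₀ + t * (a - b - P * L) - (P * (P * S) + z + P * r) +
            (z - z′ + t * (b - c - P * w) - - (P * c))
        identity = solve-∀

      -- The possibly unbounded term t E m is compensated by the running sum of E; the increments of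
      -- E are bounded because there are finitely many pairs of states.
      SumEL-linear : ∃ λ K → ∀ m → + P * + P * SumEL G π m ≤ + P * y (π 0) * + m + K
      SumEL-linear
        with Q , excess≤Q ← bounded₂ excess
        with b , -z≤b ← bounded (-_ ∘ z)
        with K , multiple ← multiple≤runningSum E Q total-excess-0 E-nonneg
               (λ k → subst (_≤ + Q) (sym (total-excess-suc k)) (excess≤Q _ _)) t
        = z (π 0) + + b + + K , λ m → ≤-by-difference
            (0≤-+ (0≤-+ (i≤j⇒0≤j-i (invariant m)) (i≤j⇒0≤j-i (-z≤b (π m))))
                  (0≤-+ (i≤j⇒0≤j-i (multiple m))
                        (0≤-* (i≤j⇒0≤j-i (+≤+ 0<P)) (runningSum-nonneg E-nonneg m))))
            (identity (+ P) (y (π 0)) (+ m) (z (π 0)) (z (π m)) (+ b) (+ K) (+ t)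
                      (SumEL G π m) (E m) (runningSum E m))
        where
        identity : ∀ P a m z₀ z b K t S E r →
          P * a * m + (z₀ + b + K) - P * P * S ≡
          P * a * m + z₀ + t * E - (P * (P * S) + z + P * r) + (b - - z)
            + (r + K - t * E + (P - 1ℤ) * r)
        identity = solve-∀

  module _ (P : ℕ) (C : ℤ) (x₀ x₁ x₂ : Fin n → ℤ) where

    private
      r₀ r₁ r₂ : Fin n → Fin n → ℤ
      r₀ s s′ = x₀ s - x₀ s′
      r₁ s s′ = x₁ s - (+ P * w s s′ + (x₁ s′ - x₀ s′))
      r₂ s s′ = x₂ s - (C * w s s′ + (x₂ s′ - x₁ s′))

    -- The discounted inequality x ≥ (P ε + C ε²) w + (1 − ε) x′ up to order ε².
    LexDecrease : Fin n → Fin n → Set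
    LexDecrease s s′ = Lex (r₀ s s′) (r₁ s s′) (r₂ s s′)

    module _ {π : ℕ → Fin n} (lex : ∀ i → LexDecrease (π i) (π (suc i))) where

      x₀-antitone : ∀ i → x₀ (π i) ≤ x₀ (π 0)
      x₀-antitone zero    = ≤-refl
      x₀-antitone (suc i) = ≤-trans (0≤i-j⇒j≤i (Lex⇒0≤ (lex i))) (x₀-antitone i)

      private
        R R′ : ℕ
        R  = proj₁ (bounded₂ (λ s s′ → - r₁ s s′))
        R′ = proj₁ (bounded₂ (λ s s′ → - r₂ s s′))

        -- Merges the two leading levels of the lexicographic order into one potential.
        y : Fin n → ℤ
        y s = (1ℤ + + R) * x₀ s + x₁ s

        -- Subtracting C y eliminates C w from P times the order-2 inequality, because P w is a
        -- difference of `y` up to the excess.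
        z : Fin n → ℤ
        z s = + P * x₂ s - C * y s

        δ : Fin n → Fin n → ℤ
        δ s s′ = (1ℤ + + R) * r₀ s s′ + r₁ s s′

        nonneg : ∀ i → 0ℤ ≤ δ (π i) (π (suc i)) ×
                       0ℤ ≤ r₂ (π i) (π (suc i)) + + R′ * δ (π i) (π (suc i))
        nonneg i = absorb R′ (proj₂ (bounded₂ (λ s s′ → - r₂ s s′)) _ _)
                     (Lex-merge R (proj₂ (bounded₂ (λ s s′ → - r₁ s s′)) _ _) (lex i))

        excess≡ : ∀ s s′ → excess π P y s s′ ≡ δ s s′ - x₀ s′
        excess≡ s s′ = identity (x₀ s) (x₀ s′) (x₁ s) (x₁ s′) (+ P) (w s s′) (+ R)
          where
          identity : ∀ a a′ b b′ P w R →
            (1ℤ + R) * a + b - ((1ℤ + R) * a′ + b′) - P * w ≡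
            (1ℤ + R) * (a - a′) + (b - (P * w + (b′ - a′))) - a′
          identity = solve-∀

      -- `x₀` never rises along the play, so it stays below 0 and contributes at least 1 to each
      -- excess: the energy level drifts to -∞.
      SumEL-diverges : x₀ (π 0) < 0ℤ → ∀ T → ∃ λ K → ∀ m → + 2 * + P * SumEL G π m ≤ + 2 * T * + m + K
      SumEL-diverges x₀<0 = SumEL-below π P y λ i →
        subst (1ℤ ≤_) (sym (excess≡ _ _)) (≤-by-difference
          (0≤-+ (proj₁ (nonneg i)) (i≤j⇒0≤j-i (i<j⇒suc[i]≤j (≤-<-trans (x₀-antitone (suc i)) x₀<0))))
          (identity (δ (π i) (π (suc i))) (x₀ (π (suc i)))))
        where
        identity : ∀ d a → d - a - 1ℤ ≡ d + (0ℤ - (1ℤ + a))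
        identity = solve-∀

      SumEL-bounded : 0 ℕ.< P → x₀ (π 0) ≡ 0ℤ → ∃ λ K → ∀ m → + P * + P * SumEL G π m ≤ + P * x₁ (π 0) * + m + K
      SumEL-bounded 0<P x₀≡0 = subst (λ a → ∃ λ K → ∀ m → + P * + P * SumEL G π m ≤ + P * a * + m + K) y≡x₁
        (SumEL-linear π P y 0<P z t
          (λ i → subst (0ℤ ≤_) (sym (excess≡ _ _)) (i≤j⇒0≤j-i (≤-trans (x₀≤0 i) (proj₁ (nonneg i)))))
          level)
        where
        t : ℕ
        -- P R′ covers negative order-2 residuals, P (1 + R) the multiple of `x₀` contained in `y`,
        -- and ∣C∣ the term C times the excess brought in by `z`.
        t = P ℕ.* R′ ℕ.+ P ℕ.* suc R ℕ.+ ∣ C ∣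
        x₀≤0 : ∀ i → x₀ (π (suc i)) ≤ 0ℤ
        x₀≤0 i = ≤-trans (x₀-antitone (suc i)) (≤-reflexive x₀≡0)
        y≡x₁ : y (π 0) ≡ x₁ (π 0)
        y≡x₁ = trans (cong (_+ x₁ (π 0)) (trans (cong (_*_ (1ℤ + + R)) x₀≡0) (*-zeroʳ (1ℤ + + R))))
                     (+-identityˡ (x₁ (π 0)))
        t≡ : + t ≡ + P * + R′ + + P * (1ℤ + + R) + + ∣ C ∣
        t≡ = cong₂ (λ a b → a + b + + ∣ C ∣) (pos-* P R′) (pos-* P (suc R))
        level : ∀ i → - (+ P * y (π (suc i))) ≤
                      z (π i) - z (π (suc i)) + + t * excess π P y (π i) (π (suc i))
        level i = ≤-by-difference
          (0≤-+ (0≤-+ (0≤-* (0≤+ {P}) (proj₂ (nonneg i)))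
                      (0≤-* (i≤j⇒0≤j-i (i≤∣i∣ C)) (i≤j⇒0≤j-i (≤-trans (x₀≤0 i) (proj₁ (nonneg i))))))
                (0≤-+ (0≤-* (0≤-* (0≤+ {P}) (0≤+ {R′})) (neg-mono-≤ (x₀≤0 i)))
                      (0≤-* (0≤-* (0≤+ {P}) (0≤+ {suc R})) (proj₁ (nonneg i)))))
          (trans (cong (λ τ → z s - z s′ + τ * excess π P y s s′ - - (+ P * y s′)) t≡)
            (identity (x₀ s) (x₀ s′) (x₁ s) (x₁ s′) (x₂ s) (x₂ s′) (w s s′)
                      (+ P) C (+ ∣ C ∣) (+ R) (+ R′)))
          where
          s  = π i
          s′ = π (suc i)
          identity : ∀ a a′ b b′ c c′ w P C D R R′ →
            P * c - C * ((1ℤ + R) * a + b) - (P * c′ - C * ((1ℤ + R) * a′ + b′))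
              + (P * R′ + P * (1ℤ + R) + D) * ((1ℤ + R) * a + b - ((1ℤ + R) * a′ + b′) - P * w)
              - - (P * ((1ℤ + R) * a′ + b′)) ≡
            P * (c - (C * w + (c′ - b′)) + R′ * ((1ℤ + R) * (a - a′) + (b - (P * w + (b′ - a′)))))
              + (D - C) * ((1ℤ + R) * (a - a′) + (b - (P * w + (b′ - a′))) - a′)
              + (P * R′ * - a′ + P * (1ℤ + R) * ((1ℤ + R) * (a - a′) + (b - (P * w + (b′ - a′)))))
          identity = solve-∀

-- Low-order coefficients of (1 - ε)^k and of the optimality equations.

discⁿ-constant-0 : ∀ k c → discⁿ k (constant c) 0 ≡ c
discⁿ-constant-0 zero    c = refl
discⁿ-constant-0 (suc k) c = discⁿ-constant-0 k c

discⁿ-constant-1 : ∀ k c → discⁿ k (constant c) 1 ≡ - (+ k * c)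
discⁿ-constant-1 zero    c = cong -_ (sym (*-zeroˡ c))
discⁿ-constant-1 (suc k) c =
  trans (cong₂ _-_ (discⁿ-constant-1 k c) (discⁿ-constant-0 k c)) (identity (+ k) c)
  where
  identity : ∀ k c → - (k * c) - c ≡ - ((1ℤ + k) * c)
  identity = solve-∀

-- The witness is -k(k - 1)/2; what matters is that it does not depend on c.
discⁿ-constant-2 : ∀ k → ∃ λ C → ∀ c → discⁿ k (constant c) 2 ≡ - (C * c)
discⁿ-constant-2 zero = 0ℤ , λ c → cong -_ (sym (*-zeroˡ c))
discⁿ-constant-2 (suc k) with C , eq ← discⁿ-constant-2 k = C - + k , λ c →
    trans (cong₂ _-_ (eq c) (discⁿ-constant-1 k c)) (identity C (+ k) c)
  where
  identity : ∀ C k c → - (C * c) - - (k * c) ≡ - ((C - k) * c)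
  identity = solve-∀

Lex-cong : ∀ {a b c a′ b′ c′} → a ≡ a′ → b ≡ b′ → c ≡ c′ → Lex a b c → Lex a′ b′ c′
Lex-cong refl refl refl lex = lex

module BackCoefficients {n : ℕ} (owner : Fin n → Player) (w : Fin n → Fin n → ℤ) where
  open DiscountedGame owner w

  -- The coefficient of ε² in 1 − (1 − ε)^(n!).
  quadratic : ℤ
  quadratic = proj₁ (discⁿ-constant-2 (n !))

  back-0 : ∀ X s s′ → back X s s′ 0 ≡ X s′ 0
  back-0 X s s′ = trans (cong (λ x → w s s′ - x + X s′ 0) (discⁿ-constant-0 (n !) (w s s′)))
                        (identity (w s s′) (X s′ 0))
    where
    identity : ∀ a b → a - a + b ≡ b
    identity = solve-∀

  back-1 : ∀ X s s′ → back X s s′ 1 ≡ + (n !) * w s s′ + (X s′ 1 - X s′ 0)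
  back-1 X s s′ = cong (_+ (X s′ 1 - X s′ 0))
    (trans (cong (λ x → 0ℤ - x) (discⁿ-constant-1 (n !) (w s s′))) (identity (+ (n !) * w s s′)))
    where
    identity : ∀ a → 0ℤ - - a ≡ a
    identity = solve-∀

  back-2 : ∀ X s s′ → back X s s′ 2 ≡ quadratic * w s s′ + (X s′ 2 - X s′ 1)
  back-2 X s s′ = cong (_+ (X s′ 2 - X s′ 1))
    (trans (cong (λ x → 0ℤ - x) (proj₂ (discⁿ-constant-2 (n !)) (w s s′))) (identity (quadratic * w s s′)))
    where
    identity : ∀ a → 0ℤ - - a ≡ a
    identity = solve-∀

-- From linear bounds to comparisons with rationals.

-- Cross-multiplied form of S(m + 1)/(m + 1) < a/(b + 1). The integer gap a D - T (b + 1) is at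
-- least 1, so m + 1 times the gap exceeds K (b + 1) once m ≥ ∣K (b + 1)∣.
eventually-below : ∀ (S : ℕ → ℤ) D T K a b → 0ℤ < D → T * + suc b < a * D →
                   (∀ m → D * S m ≤ T * + m + K) →
                   ∃ λ N → ∀ m → N ℕ.≤ m → S (suc m) * + suc b < a * + suc m
eventually-below S D T K a b 0<D T/D<a/b D*S≤ = ∣ K * + suc b ∣ , λ m N≤m →
  *-cancelˡ-<-nonNeg D ⦃ nonNegative (<⇒≤ 0<D) ⦄ (suc[i]≤j⇒i<j (≤-by-difference
    (0≤-+ (0≤-+ (0≤-* (i≤j⇒0≤j-i (D*S≤ (suc m))) (0≤+ {suc b}))
                (0≤-* (i≤j⇒0≤j-i (i<j⇒suc[i]≤j T/D<a/b)) (0≤+ {suc m})))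
          (i≤j⇒0≤j-i (≤-trans (i≤∣i∣ (K * + suc b)) (+≤+ N≤m))))
    (identity D (S (suc m)) T (+ m) K a (+ suc b))))
  where
  identity : ∀ D S T m K a b →
    D * (a * (1ℤ + m)) - (1ℤ + D * (S * b)) ≡
    (T * (1ℤ + m) + K - D * S) * b + (a * D - (1ℤ + T * b)) * (1ℤ + m) + (m - K * b)
  identity = solve-∀

toℚᵘ-/ : ∀ i d → toℚᵘ (i ℚ./ suc d) ℚᵘ.≃ mkℚᵘ i d
toℚᵘ-/ i d = ℚ.toℚᵘ-fromℚᵘ (mkℚᵘ i d)

/<⁺ : ∀ i d q → i * ↧ q < ↥ q * + suc d → i ℚ./ suc d ℚ.< q
/<⁺ i d q@record{} lt = ℚ.toℚᵘ-cancel-< (ℚᵘ.<-respˡ-≃ (ℚᵘ.≃-sym (toℚᵘ-/ i d)) (ℚᵘ.*<* lt))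

</⁺ : ∀ i d q → ↥ q * + suc d < i * ↧ q → q ℚ.< i ℚ./ suc d
</⁺ i d q@record{} lt = ℚ.toℚᵘ-cancel-< (ℚᵘ.<-respʳ-≃ (ℚᵘ.≃-sym (toℚᵘ-/ i d)) (ℚᵘ.*<* lt))

/<⁻ : ∀ i d q .⦃ _ : ℕ.NonZero d ⦄ → i ℚ./ d ℚ.< q → i * ↧ q < ↥ q * + d
/<⁻ i (suc d) q@record{} lt = ℚᵘ.drop-*<* (ℚᵘ.<-respˡ-≃ (toℚᵘ-/ i d) (ℚ.toℚᵘ-mono-< lt))

</⁻ : ∀ i d q .⦃ _ : ℕ.NonZero d ⦄ → q ℚ.< i ℚ./ d → ↥ q * + d < i * ↧ q
</⁻ i (suc d) q@record{} lt = ℚᵘ.drop-*<* (ℚᵘ.<-respʳ-≃ (toℚᵘ-/ i d) (ℚ.toℚᵘ-mono-< lt))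

-- Extended reals and their comparison with thresholds.

-∞ +∞ : ExtReal
-∞ = record
  { L = λ _ → ⊥ ; U = λ _ → ⊤ ; L-lower = λ _ () ; L-round = λ () ; U-upper = λ _ _ → tt
  ; U-round = λ {q} _ → q ℚ.- ℚ.1ℚ , q-1<q q , tt
  ; disjoint = proj₁ ; located = λ _ → inj₂ tt }
  where
  q-1<q : ∀ q → q ℚ.- ℚ.1ℚ ℚ.< q
  q-1<q q = subst (q ℚ.- ℚ.1ℚ ℚ.<_) (ℚ.+-identityʳ q) (ℚ.+-monoʳ-< q (ℚ.negative⁻¹ (ℚ.- ℚ.1ℚ)))
+∞ = record
  { L = λ _ → ⊤ ; U = λ _ → ⊥ ; L-lower = λ _ _ → tt
  ; L-round = λ {q} _ → q ℚ.+ ℚ.1ℚ , q<q+1 q , tt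
  ; U-upper = λ _ () ; U-round = λ () ; disjoint = proj₂ ; located = λ _ → inj₁ tt }
  where
  q<q+1 : ∀ q → q ℚ.< q ℚ.+ ℚ.1ℚ
  q<q+1 q = subst (ℚ._< q ℚ.+ ℚ.1ℚ) (ℚ.+-identityʳ q) (ℚ.+-monoʳ-< q (ℚ.positive⁻¹ ℚ.1ℚ))

fromℚ : ℚ → ExtReal
fromℚ v = record
  { L = ℚ._< v ; U = v ℚ.<_
  ; L-lower = ℚ.<-trans
  ; L-round = λ q<v → let r , q<r , r<v = ℚ.<-dense q<v in r , q<r , r<v
  ; U-upper = λ q<r v<q → ℚ.<-trans v<q q<r
  ; U-round = λ v<q → let r , v<r , r<q = ℚ.<-dense v<q in r , r<q , v<r
  ; disjoint = λ (q<v , v<q) → ℚ.<-asym q<v v<q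
  ; located = λ {q} {r} q<r → located q r q<r (q ℚ.<? v) }
  where
  located : ∀ q r → q ℚ.< r → _ → q ℚ.< v ⊎ v ℚ.< r
  located q r q<r (yes q<v) = inj₁ q<v
  located q r q<r (no  q≮v) = inj₂ (ℚ.≤-<-trans (ℚ.≮⇒≥ q≮v) q<r)

LimsupLe⇒LiminfLe : ∀ a v → LimsupLe a v → LiminfLe a v
LimsupLe⇒LiminfLe a v le q v<q N with N₀ , a<q ← le q v<q =
  N ℕ.⊔ N₀ , ℕ.m≤m⊔n N N₀ , a<q _ (ℕ.m≤n⊔m N N₀)

LiminfGe⇒LimsupGe : ∀ a v → LiminfGe a v → LimsupGe a v
LiminfGe⇒LimsupGe a v ge q q<v N with N₀ , q<a ← ge q q<v =
  N ℕ.⊔ N₀ , ℕ.m≤m⊔n N N₀ , q<a _ (ℕ.m≤n⊔m N N₀)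

-- Decides v ≤ t against v > t, which locatedness alone does not provide; in the second case a
-- rational strictly between them is given.
Comparable : ExtReal → Set
Comparable v = ∀ t → (∀ q → t ℚ.< q → ExtReal.U v q) ⊎ (∃ λ q → t ℚ.< q × ExtReal.L v q)

fromℚ-comparable : ∀ v → Comparable (fromℚ v)
fromℚ-comparable v t with t ℚ.<? v
... | no  t≮v = inj₁ λ q t<q → ℚ.≤-<-trans (ℚ.≮⇒≥ t≮v) t<q
... | yes t<v = let r , t<r , r<v = ℚ.<-dense t<v in inj₂ (r , t<r , r<v)

-- Negated weights, turning lower bounds into upper bounds, and bounds on averages.

negate : Game → Game
negate G = record { n = n ; owner = owner ; edge = edge ; w = λ s s′ → - w s s′ ; total = total }
  where open Game G

EL-negate : ∀ G π k → EL (negate G) π k ≡ - EL G π k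
EL-negate G π zero    = refl
EL-negate G π (suc k) =
  trans (cong (_+ - Game.w G (π k) (π (suc k))) (EL-negate G π k)) (sym (neg-distrib-+ (EL G π k) _))

SumEL-negate : ∀ G π m → SumEL (negate G) π m ≡ - SumEL G π m
SumEL-negate G π zero    = refl
SumEL-negate G π (suc m) =
  trans (cong₂ _+_ (SumEL-negate G π m) (EL-negate G π (suc m))) (sym (neg-distrib-+ (SumEL G π m) _))

0<-* : ∀ {m n} → 0 ℕ.< m → 0 ℕ.< n → 0ℤ < + m * + n
0<-* {m} {n} 0<m 0<n = subst (0ℤ <_) (pos-* m n) (+<+ (ℕ.*-mono-≤ 0<m 0<n))

-- Gives a slope T/P below the rational a/(b + 1), as needed when the value is infinite.
slope-below : ∀ a b P → ∃ λ T → + 2 * T * + suc b < a * (+ 2 * + P)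
slope-below a b P = - (1ℤ + + ∣ - a ∣ * + P) , suc[i]≤j⇒i<j (≤-by-difference
    (0≤-+ (0≤-* (0≤-* (0≤+ {2}) (0≤+ {P})) (i≤j⇒0≤j-i (i≤∣i∣ (- a))))
          (0≤-+ (0≤-* (0≤-* (0≤-* (0≤+ {2}) (0≤+ {∣ - a ∣})) (0≤+ {P})) (0≤+ {b}))
                (0≤-+ (0≤+ {1}) (0≤-* (0≤+ {2}) (0≤+ {b})))))
    (identity a (+ ∣ - a ∣) (+ b) (+ P)))
  where
  identity : ∀ a A b P → a * (+ 2 * P) - (1ℤ + + 2 * - (1ℤ + A * P) * (1ℤ + b)) ≡
             + 2 * P * (A - - a) + (+ 2 * A * P * b + (1ℤ + + 2 * b))
  identity = solve-∀

scale-slope : ∀ {P} x a b → 0 ℕ.< P → x * b < a * + P → + P * x * b < a * (+ P * + P)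
scale-slope {P} x a b 0<P lt = suc[i]≤j⇒i<j (≤-by-difference
    (0≤-+ (0≤-* (0≤+ {P}) (i≤j⇒0≤j-i (i<j⇒suc[i]≤j lt))) (i≤j⇒0≤j-i (+≤+ 0<P)))
    (identity x a b (+ P)))
  where
  identity : ∀ x a b P → a * (P * P) - (1ℤ + P * x * b) ≡ P * (a * P - (1ℤ + x * b)) + (P - 1ℤ)
  identity = solve-∀

avg-below : ∀ G π D T K q → 0ℤ < D → T * ↧ q < ↥ q * D → (∀ m → D * SumEL G π m ≤ T * + m + K) →
            ∃ λ N → ∀ m → m ℕ.≥ N → avg G π m ℚ.< q
avg-below G π D T K q@record{} 0<D T/D<q bound
  with N , below ← eventually-below (SumEL G π) D T K (↥ q) (ℚ.ℚ.denominator-1 q) 0<D T/D<q bound =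
  N , λ m N≤m → /<⁺ (SumEL G π (suc m)) m q (below m N≤m)

avg-above : ∀ G π D T K q → 0ℤ < D → T * ↧ q < - ↥ q * D →
            (∀ m → D * SumEL (negate G) π m ≤ T * + m + K) →
            ∃ λ N → ∀ m → m ℕ.≥ N → avg G π m ℚ.> q
avg-above G π D T K q@record{} 0<D T/D<-q bound
  with N , below ← eventually-below (SumEL (negate G) π) D T K (- ↥ q) (ℚ.ℚ.denominator-1 q) 0<D T/D<-q bound =
  N , λ m N≤m → </⁺ (SumEL G π (suc m)) m q (neg-cancel-< (subst₂ _<_
    (trans (cong (_* ↧ q) (SumEL-negate G π (suc m))) (sym (neg-distribˡ-* (SumEL G π (suc m)) (↧ q))))
    (sym (neg-distribˡ-* (↥ q) (+ suc m))) (below m N≤m)))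

-- Values, strategies and determinacy.

module _ (G : Game) where
  open Game G
  open DiscountedGame owner w
  open BackCoefficients owner w

  solution : Solution (λ s s′ → edge s s′ ≡ true)
  solution = Solution-resp
    [ (λ where refl → proj₂ (total _)) , (λ s′∈ → proj₂ (∈-filter⁻ (λ s′ → edge _ s′ Bool.≟ true) {xs = allFin n} s′∈)) ]′
    (λ {s} {s′} e → inj₂ (∈-filter⁺ (λ s′ → edge s s′ Bool.≟ true) (∈-allFin s′) e))
    (solve (allFin n) (proj₁ ∘ total) (λ s → filter (λ s′ → edge s s′ Bool.≟ true) (allFin n))
           (λ s → inj₁ (∈-allFin s)))

  open Solution solution

  -- One choice function serves both players, since each follows it only at its own states.
  strategy : Memoryless G
  strategy = record { choose = best ; legal = legal }

  x₀ x₁ x₂ : Fin n → ℤ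
  x₀ s = X s 0
  x₁ s = X s 1
  x₂ s = X s 2

  module _ {s₀ : State G} (ρ : Play G s₀) where
    open Play ρ

    X-decreases : Consistent G P1 strategy ρ → ∀ i → back X (π i) (π (suc i)) ⪯ X (π i)
    X-decreases cons i with owner (π i) in owner-i
    ... | P1 = inj₁ λ k → i≡j⇒i-j≡0 (trans (attain (π i) k) (cong (λ s′ → back X (π i) s′ k) (sym (cons i owner-i))))
    ... | P2 = max owner-i (step i)

    X-increases : Consistent G P2 strategy ρ → ∀ i → X (π i) ⪯ back X (π i) (π (suc i))
    X-increases cons i with owner (π i) in owner-i
    ... | P1 = min owner-i (step i)
    ... | P2 = inj₁ λ k → i≡j⇒i-j≡0 (sym (trans (attain (π i) k) (cong (λ s′ → back X (π i) s′ k) (sym (cons i owner-i)))))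

    lex-decreases : Consistent G P1 strategy ρ → ∀ i →
      LexDecrease G (n !) quadratic x₀ x₁ x₂ (π i) (π (suc i))
    lex-decreases cons i = Lex-cong
      (cong (λ x → x₀ (π i) - x) (back-0 X (π i) (π (suc i))))
      (cong (λ x → x₁ (π i) - x) (back-1 X (π i) (π (suc i))))
      (cong (λ x → x₂ (π i) - x) (back-2 X (π i) (π (suc i))))
      (NonNeg⇒Lex (X-decreases cons i))

    lex-increases : Consistent G P2 strategy ρ → ∀ i →
      LexDecrease (negate G) (n !) quadratic (-_ ∘ x₀) (-_ ∘ x₁) (-_ ∘ x₂) (π i) (π (suc i))
    lex-increases cons i = Lex-cong
      (trans (cong (λ x → x - x₀ s) (back-0 X s s′)) (identity₀ (x₀ s) (x₀ s′)))
      (trans (cong (λ x → x - x₁ s) (back-1 X s s′)) (identity₁ (x₁ s) (+ (n !)) (w s s′) (x₁ s′) (x₀ s′)))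
      (trans (cong (λ x → x - x₂ s) (back-2 X s s′)) (identity₁ (x₂ s) quadratic (w s s′) (x₂ s′) (x₁ s′)))
      (NonNeg⇒Lex (X-increases cons i))
      where
      s  = π i
      s′ = π (suc i)
      identity₀ : ∀ a b → b - a ≡ - a - - b
      identity₀ = solve-∀
      identity₁ : ∀ a P w b c → P * w + (b - c) - a ≡ - a - (P * - w + (- b - - c))
      identity₁ = solve-∀

  instance
    n!-nonZero : ℕ.NonZero (n !)
    n!-nonZero = n ℕ.!≢0

  -- To leading order X is n! ε times the discounted value, so `x₀` is n! times the mean-payoff
  -- value. If that is 0, `x₁` is n! times the limit of the discounted values, which is the average
  -- energy.
  value : State G → ExtReal
  value s₀ with <-cmp (x₀ s₀) 0ℤ
  ... | tri< _ _ _ = -∞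
  ... | tri≈ _ _ _ = fromℚ (x₁ s₀ ℚ./ (n !))
  ... | tri> _ _ _ = +∞

  value-comparable : ∀ s₀ → Comparable (value s₀)
  value-comparable s₀ t with <-cmp (x₀ s₀) 0ℤ
  ... | tri< _ _ _ = inj₁ λ _ _ → tt
  ... | tri≈ _ _ _ = fromℚ-comparable (x₁ s₀ ℚ./ (n !)) t
  ... | tri> _ _ _ = inj₂ (proj₁ (ExtReal.L-round +∞ {t} tt) , proj₁ (proj₂ (ExtReal.L-round +∞ {t} tt)) , tt)

  limsup≤value : ∀ {s₀} (ρ : Play G s₀) → Consistent G P1 strategy ρ → AEsup≤ G ρ (value s₀)
  limsup≤value ρ@record { π = π ; start = refl } cons q@record{} v<q with <-cmp (x₀ (π 0)) 0ℤ
  -- For positive `x₀` the value is +∞ and no rational lies above it, which leaves two cases.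
  ... | tri< x₀<0 _ _ =
    let T , T<q   = slope-below (↥ q) (ℚ.ℚ.denominator-1 q) (n !)
        K , bound = SumEL-diverges G (n !) quadratic x₀ x₁ x₂ (lex-decreases ρ cons) x₀<0 T
    in avg-below G π (+ 2 * + (n !)) (+ 2 * T) K q (0<-* {2} (ℕ.s≤s ℕ.z≤n) (ℕ.1≤n! n)) T<q bound
  ... | tri≈ _ x₀≡0 _ =
    let K , bound = SumEL-bounded G (n !) quadratic x₀ x₁ x₂ (lex-decreases ρ cons) (ℕ.1≤n! n) x₀≡0
    in avg-below G π (+ (n !) * + (n !)) (+ (n !) * x₁ (π 0)) K q (0<-* (ℕ.1≤n! n) (ℕ.1≤n! n))
         (scale-slope (x₁ (π 0)) (↥ q) (↧ q) (ℕ.1≤n! n) (/<⁻ (x₁ (π 0)) (n !) q v<q)) bound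

  value≤liminf : ∀ {s₀} (ρ : Play G s₀) → Consistent G P2 strategy ρ → AEinf≥ G ρ (value s₀)
  value≤liminf ρ@record { π = π ; start = refl } cons q@record{} q<v with <-cmp (x₀ (π 0)) 0ℤ
  ... | tri≈ _ x₀≡0 _ =
    let K , bound = SumEL-bounded (negate G) (n !) quadratic
                      (-_ ∘ x₀) (-_ ∘ x₁) (-_ ∘ x₂) (lex-increases ρ cons) (ℕ.1≤n! n) (cong -_ x₀≡0)
    in avg-above G π (+ (n !) * + (n !)) (+ (n !) * - x₁ (π 0)) K q (0<-* (ℕ.1≤n! n) (ℕ.1≤n! n))
         (scale-slope (- x₁ (π 0)) (- ↥ q) (↧ q) (ℕ.1≤n! n)
           (subst₂ _<_ (neg-distribˡ-* (x₁ (π 0)) (↧ q)) (neg-distribˡ-* (↥ q) (+ (n !)))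
             (neg-mono-< (</⁻ (x₁ (π 0)) (n !) q q<v)))) bound
  ... | tri> _ _ 0<x₀ =
    let T , T<-q  = slope-below (- ↥ q) (ℚ.ℚ.denominator-1 q) (n !)
        K , bound = SumEL-diverges (negate G) (n !) quadratic
                      (-_ ∘ x₀) (-_ ∘ x₁) (-_ ∘ x₂) (lex-increases ρ cons) (neg-mono-< 0<x₀) T
    in avg-above G π (+ 2 * + (n !)) (+ 2 * T) K q (0<-* {2} (ℕ.s≤s ℕ.z≤n) (ℕ.1≤n! n)) T<-q bound

  -- Player 1 wins if v ≤ t; otherwise player 2 keeps the averages eventually above some rational q
  -- > t. Abstracting `W` covers limsup and liminf together.
  threshold : ∀ {W : ∀ {s₀} → Play G s₀ → Set} s₀ t →
    ((∀ q → t ℚ.< q → ExtReal.U (value s₀) q) → ∀ (ρ : Play G s₀) → AEsup≤ G ρ (value s₀) → W ρ) →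
    (∀ q → t ℚ.< q → ExtReal.L (value s₀) q → ∀ (ρ : Play G s₀) → AEinf≥ G ρ (value s₀) → ¬ W ρ) →
    ThresholdDetermined G s₀ W
  threshold s₀ t win₁ win₂ with value-comparable s₀ t
  ... | inj₁ above         = inj₁ (strategy , λ ρ cons → win₁ above ρ (limsup≤value ρ cons))
  ... | inj₂ (q , t<q , q<v) = inj₂ (strategy , λ ρ cons → win₂ q t<q q<v ρ (value≤liminf ρ cons))

theorem3 : (G : Game) (s₀ : State G) →
    Determined G s₀ (AEsup≤ G) (AEsup≥ G) ×
    Determined G s₀ (AEinf≤ G) (AEinf≥ G) ×
    (∀ (t : ℚ) → ThresholdDetermined G s₀ (InAvgEnergy G t)) ×
    (∀ (t : ℚ) → ThresholdDetermined G s₀ (InAvgEnergyInf G t))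
theorem3 G s₀ =
    -- Each player secures the stronger bound, limsup ≤ v for player 1 and liminf ≥ v for player 2,
    -- so both versions share the value and the strategies.
    (v , σ , σ , limsup≤value G , λ ρ cons → LiminfGe⇒LimsupGe _ v (value≤liminf G ρ cons))
  , (v , σ , σ , (λ ρ cons → LimsupLe⇒LiminfLe _ v (limsup≤value G ρ cons)) , value≤liminf G)
  , (λ t → threshold G s₀ t
      (λ above ρ le q t<q → le q (above q t<q))
      (λ q t<q q<v ρ ge sup≤t →
        let N , q<a = ge q q<v ; N′ , a<q = sup≤t q t<q
        in ℚ.<-asym (q<a (N ℕ.⊔ N′) (ℕ.m≤m⊔n N N′)) (a<q (N ℕ.⊔ N′) (ℕ.m≤n⊔m N N′))))
  , (λ t → threshold G s₀ t
      (λ above ρ le q t<q → LimsupLe⇒LiminfLe _ v le q (above q t<q))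
      (λ q t<q q<v ρ ge inf≤t →
        let N , q<a = ge q q<v ; m , N≤m , a<q = inf≤t q t<q N
        in ℚ.<-asym (q<a m N≤m) a<q))
  where
  v = value G s₀
  σ = strategy G
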